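{- There exists a polynomial time (randomized) $0.483$-competitive online algorithm for the dicut model.
   Context: The dicut model: there is a directed graph $G=(V,A)$ with non-negative arc weights, and an unknown ground set $\mathcal N=\{u_1,\dots,u_n\}\subseteq V$. The objective $f:2^{\mathcal N}\to\mathbb R_{\ge0}$ is the cut function: $f(S)$ is the total weight of arcs of $G$ going from a node of $S$ to a node of $V\setminus S$. The elements of $\mathcal N$ are revealed one by one in the order $u_1,\dots,u_n$, chosen by an adversary. The algorithm knows $V$, but does not know $\mathcal N$ or $n$ in advance. At any time it can query the existence and weight of every arc leaving a node that has already been revealed. It maintains solutions $S_0=\varnothing,S_1,\dots,S_n$, where immediately after $u_i$ is revealed it chooses (possibly at random) $S_i$ to be any subset of $S_{i-1}\cup\{u_i\}$, based only on the information available so far and internal randomness. Every subset of $\mathcal N$ is feasible. The algorithm is $\alpha$-competitive if $\mathbb E[f(S_n)]\ge\alpha\cdot\max_{S\subseteq\mathcal N}f(S)$ for every instance. Polynomial time means polynomial in $|V|$, with arithmetic operations and comparisons of numbers, and drawing uniformly random numbers from $[0,1]$, counted as elementary operations. -}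

module Defs where

open import Algebra.Bundles using (CommutativeRing)
open import Algebra.Core using (Op₁; Op₂)
open import Algebra.Structures using (IsCommutativeRing)
open import Algebra.Properties.Monoid.Sum as MonoidSum using ()
open import Data.Bool.Base using (Bool; true; false; if_then_else_; _∧_; not)
open import Data.Fin.Base using (Fin; toℕ; fromℕ<)
open import Data.Fin.Subset using (Subset; _∈_; _∪_; ⁅_⁆; _-_) renaming (⊥ to ∅)
open import Data.List.Base using (List; []; _∷_)
open import Data.List.Membership.Propositional using () renaming (_∈_ to _∈ˡ_)
open import Data.List.Relation.Unary.Unique.Propositional using (Unique)
open import Data.Maybe.Base using (Maybe; just; nothing; fromMaybe; is-just; maybe′)
open import Data.Maybe.Relation.Unary.All using () renaming (All to AllMaybe)
open import Data.Nat.Base as ℕ using (ℕ; zero; suc; _≡ᵇ_)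
import Data.Nat.Properties as ℕ
open import Data.Product.Base using (Σ-syntax; ∃; ∃-syntax; _×_; _,_)
open import Data.Vec.Base using (lookup)
open import Level using (0ℓ)
open import Relation.Binary.Core using (Rel)
open import Relation.Binary.PropositionalEquality.Core using (_≡_; _≢_)
open import Relation.Binary.Structures using (IsDecTotalOrder)
open import Relation.Nullary.Decidable.Core using (yes; no; ⌊_⌋)

-- The library has no real numbers.  They are given by the classical axioms
-- of a complete ordered field, which have exactly one model up to
-- isomorphism.  Comparisons are decidable because the real-number machine
-- below branches on them.  Inversion is total, with the convention 0⁻¹ = 0.

record RealNumbers : Set₁ where
  infix  4 _≤_ _<_
  infixl 6 _+_ _−_
  infixl 7 _*_ _/_
  infix  8 -_ _⁻¹
  field
    ℝ                 : Set
    _+_ _*_           : Op₂ ℝ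
    -_ _⁻¹            : Op₁ ℝ
    0# 1#             : ℝ
    _≤_               : Rel ℝ 0ℓ
    isCommutativeRing : IsCommutativeRing _≡_ _+_ _*_ -_ 0# 1#
    0≢1               : 0# ≢ 1#
    *-inverseʳ        : ∀ x → x ≢ 0# → x * x ⁻¹ ≡ 1#
    0⁻¹≡0             : 0# ⁻¹ ≡ 0#
    isDecTotalOrder   : IsDecTotalOrder _≡_ _≤_
    +-monoˡ-≤         : ∀ z {x y} → x ≤ y → x + z ≤ y + z
    *-nonneg          : ∀ {x y} → 0# ≤ x → 0# ≤ y → 0# ≤ x * y

  UpperBound : (ℝ → Set) → ℝ → Set
  UpperBound P b = ∀ x → P x → x ≤ b

  field
    supremum : (P : ℝ → Set) → ∃ P → ∃ (UpperBound P) →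
               ∃[ s ] UpperBound P s × (∀ b → UpperBound P b → s ≤ b)

  commutativeRing : CommutativeRing 0ℓ 0ℓ
  commutativeRing = record { isCommutativeRing = isCommutativeRing }

  open MonoidSum (CommutativeRing.+-monoid commutativeRing) public using (sum)
  open IsDecTotalOrder isDecTotalOrder public using (_≤?_)

  _<_ : Rel ℝ 0ℓ
  x < y = x ≤ y × x ≢ y

  _−_ _/_ : Op₂ ℝ
  x − y = x + (- y)
  x / y = x * y ⁻¹

  fromℕ : ℕ → ℝ
  fromℕ zero    = 0#
  fromℕ (suc n) = 1# + fromℕ n

------------------------------------------------------------------------
-- Programs for a random access machine with unit-cost real arithmetic

-- Memory consists of ℕ-valued and ℝ-valued arrays; arrays are named by
-- natural numbers and their cells are indexed by natural numbers.  An
-- expression has a size fixed by the program, so evaluating it costs a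
-- constant number of elementary operations.  Index arithmetic is restricted
-- to addition and truncated subtraction, so that no exponentially long
-- integers can be built in polynomially many steps.

data NatExp : Set where
  lit       : ℕ → NatExp
  ∣V∣       : NatExp                   -- the number of nodes of the graph
  arriving  : NatExp                   -- the node just revealed
  natCell   : ℕ → NatExp → NatExp
  _⊕_ _⊖_   : NatExp → NatExp → NatExp

data RealExp : Set where
  lit             : ℕ → RealExp
  realCell        : ℕ → NatExp → RealExp
  weight          : NatExp → NatExp → RealExp      -- query: weight of an arc
  _⊕_ _⊖_ _⊗_ _⊘_ : RealExp → RealExp → RealExp

data Test : Set where
  _≤ᴺ_ : NatExp → NatExp → Test
  _≤ᴿ_ : RealExp → RealExp → Test
  arc  : NatExp → NatExp → Test                    -- query: existence of an arc

infixr 5 _⨾_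

data Program : Set where
  skip    : Program
  _⨾_     : Program → Program → Program
  setNat  : ℕ → NatExp → NatExp → Program    -- array, index, new value
  setReal : ℕ → NatExp → RealExp → Program
  draw    : ℕ → NatExp → Program             -- store a uniform number from [0,1]
  discard : NatExp → Program                 -- remove a node from the solution
  ifElse  : Test → Program → Program → Program
  while   : Test → Program → Program

module Dicut (ℛ : RealNumbers) where
  open RealNumbers ℛ

  ----------------------------------------------------------------------
  -- The dicut problem

  record Digraph (m : ℕ) : Set where
    field
      arcs   : Fin m → Fin m → Maybe ℝ      -- nothing: there is no such arc
      nonneg : ∀ u v → AllMaybe (0# ≤_) (arcs u v)

  open Digraph

  cut : ∀ {m} → Digraph m → Subset m → ℝ
  cut G S = sum λ u → sum λ v →
    if lookup S u ∧ not (lookup S v) then fromMaybe 0# (arcs G u v) else 0#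

  record Instance : Set where
    field
      size     : ℕ
      graph    : Digraph size
      arrivals : List (Fin size)            -- the ground set, in order of arrival
      distinct : Unique arrivals

    Feasible : Subset size → Set
    Feasible S = ∀ {v} → v ∈ S → v ∈ˡ arrivals

    IsOptimum : ℝ → Set
    IsOptimum o = (Σ[ S ∈ Subset size ] Feasible S × cut graph S ≡ o)
                × (∀ S → Feasible S → cut graph S ≤ o)

  ----------------------------------------------------------------------
  -- Randomness: a sequence of independent uniform numbers from [0,1]

  record UnitReal : Set where
    constructor unit
    field
      value : ℝ
      0≤    : 0# ≤ value
      ≤1    : value ≤ 1#

  open UnitReal

  Tape : Set
  Tape = ℕ → UnitReal

  cons : UnitReal → Tape → Tape
  cons x ω zero    = x
  cons x ω (suc i) = ω i

  -- Tagged partitions of the interval from a to b with mesh at most δ.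
  data Partition (δ : ℝ) : ℝ → ℝ → Set where
    done : ∀ {a} → Partition δ a a
    cell : ∀ {a c b} (t : UnitReal) → a ≤ value t → value t ≤ c → c − a ≤ δ →
           Partition δ c b → Partition δ a b

  riemannSum : ∀ {δ a b} → (UnitReal → ℝ) → Partition δ a b → ℝ
  riemannSum h done                       = 0#
  riemannSum h (cell {a} {c} t _ _ _ rest) = h t * (c − a) + riemannSum h rest

  -- h is Riemann integrable on [0,1] with integral v.
  IsIntegral : (UnitReal → ℝ) → ℝ → Set
  IsIntegral h v = ∀ ε → 0# < ε → ∃[ δ ] 0# < δ ×
    ((P : Partition δ 0# 1#) →
      riemannSum h P ≤ v + ε × v ≤ riemannSum h P + ε)

  -- A function depending on finitely many draws is integrated one draw at
  -- a time.  By Fubini, v is then the expectation of g with respect to the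
  -- product of the uniform distributions.
  data IsExpectation (g : Tape → ℝ) (v : ℝ) : Set where
    const     : (∀ ω → g ω ≡ v) → IsExpectation g v
    integrate : (h : UnitReal → ℝ) →
                (∀ x → IsExpectation (λ ω → g (cons x ω)) (h x)) →
                IsIntegral h v → IsExpectation g v

  ----------------------------------------------------------------------
  -- Executing a program on one arrival

  record Store (m : ℕ) : Set where
    field
      nats     : ℕ → ℕ → ℕ
      reals    : ℕ → ℕ → ℝ
      solution : Subset m
      drawn    : ℕ                          -- how much of the tape has been used

  open Store

  update : ∀ {A : Set} → (ℕ → ℕ → A) → ℕ → ℕ → A → (ℕ → ℕ → A)
  update μ a i x b j = if (a ≡ᵇ b) ∧ (i ≡ᵇ j) then x else μ b j

  node : ∀ {m} → ℕ → Maybe (Fin m)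
  node {m} i with i ℕ.<? m
  ... | yes i<m = just (fromℕ< i<m)
  ... | no  _   = nothing

  module _ {m : ℕ} (G : Digraph m) (ω : Tape)
           (revealed : Subset m) (new : Fin m) where

    -- Only arcs leaving a revealed node are visible; any other query gets
    -- the answer "no arc" irrespective of the graph.
    query : ℕ → ℕ → Maybe ℝ
    query i j with node i | node j
    ... | just u | just v = if lookup revealed u then arcs G u v else nothing
    ... | _      | _      = nothing

    evalNat : Store m → NatExp → ℕ
    evalNat s (lit k)       = k
    evalNat s ∣V∣           = m
    evalNat s arriving      = toℕ new
    evalNat s (natCell a i) = nats s a (evalNat s i)
    evalNat s (e ⊕ e′)      = evalNat s e ℕ.+ evalNat s e′
    evalNat s (e ⊖ e′)      = evalNat s e ℕ.∸ evalNat s e′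

    evalReal : Store m → RealExp → ℝ
    evalReal s (lit k)        = fromℕ k
    evalReal s (realCell a i) = reals s a (evalNat s i)
    evalReal s (weight i j)   = fromMaybe 0# (query (evalNat s i) (evalNat s j))
    evalReal s (e ⊕ e′)       = evalReal s e + evalReal s e′
    evalReal s (e ⊖ e′)       = evalReal s e − evalReal s e′
    evalReal s (e ⊗ e′)       = evalReal s e * evalReal s e′
    evalReal s (e ⊘ e′)       = evalReal s e / evalReal s e′

    evalTest : Store m → Test → Bool
    evalTest s (e ≤ᴺ e′) = ⌊ evalNat s e ℕ.≤? evalNat s e′ ⌋
    evalTest s (e ≤ᴿ e′) = ⌊ evalReal s e ≤? evalReal s e′ ⌋
    evalTest s (arc i j) = is-just (query (evalNat s i) (evalNat s j))

    -- The list is the stack of programs that remain to be executed.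
    Config : Set
    Config = List Program × Store m

    step : Program → List Program → Store m → Config
    step skip            k s = k , s
    step (p ⨾ q)         k s = p ∷ q ∷ k , s
    step (setNat a i e)  k s =
      k , record s { nats = update (nats s) a (evalNat s i) (evalNat s e) }
    step (setReal a i e) k s =
      k , record s { reals = update (reals s) a (evalNat s i) (evalReal s e) }
    step (draw a i)      k s =
      k , record s { reals = update (reals s) a (evalNat s i) (value (ω (drawn s)))
                   ; drawn = suc (drawn s) }
    step (discard e)     k s =
      k , record s { solution = maybe′ (λ v → solution s - v) (solution s) (node (evalNat s e)) }
    step (ifElse b p q)  k s = (if evalTest s b then p ∷ k else q ∷ k) , s
    step (while b p)     k s = (if evalTest s b then p ∷ while b p ∷ k else k) , s

    -- Halts c t s: from configuration c, the machine stops after exactly t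
    -- steps with final store s.
    data Halts : Config → ℕ → Store m → Set where
      halt : ∀ {s} → Halts ([] , s) 0 s
      next : ∀ {p k s t s′} → Halts (step p k s) t s′ →
             Halts (p ∷ k , s) (suc t) s′

  ----------------------------------------------------------------------
  -- Online algorithms

  initial : ∀ m → Store m
  initial m = record
    { nats = λ _ _ → 0 ; reals = λ _ _ → 0# ; solution = ∅ ; drawn = 0 }

  insert : ∀ {m} → Fin m → Store m → Store m
  insert u s = record s { solution = solution s ∪ ⁅ u ⁆ }

  -- An online algorithm is a program executed once per arrival, with memory
  -- persisting between arrivals.  When u arrives it is put into the solution,
  -- from which the program may then discard arbitrary nodes; so the new
  -- solution is an arbitrary subset of the old one plus u.
  --
  -- Online A G ω R s us t s′: with the nodes in R already revealed, starting
  -- from store s, processing the arrivals us takes t steps in total and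
  -- ends in s′.
  data Online {m} (A : Program) (G : Digraph m) (ω : Tape) :
              Subset m → Store m → List (Fin m) → ℕ → Store m → Set where
    end    : ∀ {R s} → Online A G ω R s [] 0 s
    arrive : ∀ {R s u us t t′ s′ s″} →
             Halts G ω (R ∪ ⁅ u ⁆) u (A ∷ [] , insert u s) t s′ →
             Online A G ω (R ∪ ⁅ u ⁆) s′ us t′ s″ →
             Online A G ω R s (u ∷ us) (t ℕ.+ t′) s″

  module _ (A : Program) (I : Instance) where
    open Instance I

    Runs : Tape → ℕ → Store size → Set
    Runs ω = Online A graph ω ∅ (initial size) arrivals

    RunsWithin : ℕ → Set
    RunsWithin T = ∀ ω → ∃[ t ] ∃[ s ] Runs ω t s × t ℕ.≤ T

    Outputs : (Tape → Subset size) → Set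
    Outputs S = ∀ ω → ∃[ t ] ∃[ s ] Runs ω t s × solution s ≡ S ω

  PolynomialTime : Program → Set
  PolynomialTime A = ∃[ c ] ∃[ d ] ∀ I →
    RunsWithin A I (c ℕ.* Instance.size I ℕ.^ d ℕ.+ c)

  Competitive : Program → ℝ → Set
  Competitive A α = ∀ I → let open Instance I in
    ∃[ S ] ∃[ e ] ∃[ o ] Outputs A I S
      × IsExpectation (λ ω → cut graph (S ω)) e
      × IsOptimum o
      × α * o ≤ e

{-# OPTIONS --safe #-}

module Submission where

-- Feige and Jozeph's oblivious rounding: a node v with total weight out v leaving it and
-- in v entering it is chosen with a probability that depends only on its bias
-- out v / (out v + in v).  When a node arrives its outgoing arcs are all visible, and later
-- arrivals can only add incoming weight, so the bias decreases over time.  Hence the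
-- selection probability is monotone and a single uniform draw per node, compared with the
-- current probability, implements the rounding online.
--
-- The selection probability is the step function with value (2k - 1)/200 on biases between
-- (49 + k)/200 and (50 + k)/200.  Its ratio is certified by LP duality.  For an arbitrary
-- set T, a node v of class k on side a (whether v ∈ T) gets the multiplier
-- z = 6k - pivot a, to be used with the lower end of the class if z ≥ 0 and with the upper
-- end otherwise.  Weighting the bias constraints of all nodes by these multipliers and
-- summing over all arcs reduces the claim to an inequality between natural numbers for every
-- pair of classes and sides, which is checked by evaluation.

open import Defs
open import Algebra.Bundles using (CommutativeRing)
import Algebra.Properties.CommutativeMonoid.Sum as CommutativeMonoidSum
import Algebra.Properties.Ring as RingProperties
import Algebra.Properties.Semiring.Sum as SemiringSum
import Algebra.Solver.Ring as RingSolver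
open import Algebra.Solver.Ring.AlmostCommutativeRing using (fromCommutativeRing; _-Raw-AlmostCommutative⟶_)
open import Data.Bool.Base using (Bool; true; false; if_then_else_; _∧_; _∨_; not; T)
open import Data.Bool.ListAction using (all)
open import Data.Bool.Properties using (∧-identityʳ; ∧-zeroʳ; ∨-identityʳ; ∨-zeroʳ; T-≡)
open import Data.Fin.Base using (Fin; zero; suc; toℕ; fromℕ<)
open import Data.Fin.Properties using (_≟_; toℕ<n; fromℕ<-toℕ; toℕ-fromℕ<; toℕ-injective; injective⇒≤)
open import Data.Fin.Subset using (Subset; _∈_; _∩_; ⁅_⁆; _∪_; _─_; _-_) renaming (⊥ to ∅)
open import Data.Fin.Subset.Properties using (⊆-antisym; p∩q⊆p; x∈p∩q⁺; x∈p∩q⁻)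
open import Data.Integer.Base as ℤ using (ℤ) renaming (+_ to pos; -[1+_] to negsuc)
import Data.Integer.Properties as ℤ
open import Data.List.Base as List using (List; []; _∷_; length; upTo)
open import Data.List.Membership.Propositional using () renaming (_∈_ to _∈ˡ_)
open import Data.List.Membership.Propositional.Properties using (∈-lookup; ∈-upTo⁺)
open import Data.List.Relation.Unary.All as All using (All; []; _∷_)
open import Data.List.Relation.Unary.All.Properties using (all⁺)
open import Data.List.Relation.Unary.AllPairs using ([]; _∷_)
open import Data.List.Relation.Unary.Any using (here; there)
open import Data.List.Relation.Unary.Unique.Propositional using (Unique)
open import Data.Maybe.Base using (Maybe; just; nothing; fromMaybe; maybe′)
open import Data.Maybe.Relation.Unary.All using () renaming (just to just-all)
open import Data.Nat.Base as ℕ using (ℕ; zero; suc; z≤n; s≤s; _∸_; _≡ᵇ_; _<ᵇ_)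
import Data.Nat.Properties as ℕ
import Data.Nat.Tactic.RingSolver as ℕSolver
open import Data.Product.Base using (∃-syntax; _×_; _,_; proj₁; proj₂)
open import Data.Sum.Base using (_⊎_; inj₁; inj₂; [_,_]′)
open import Data.Vec.Base using ([]; _∷_; lookup; tabulate)
open import Data.Vec.Properties using (lookup-replicate; lookup-zipWith; lookup∘tabulate; tabulate∘lookup; tabulate-cong; []=⇒lookup; lookup⇒[]=)
open import Function.Base using (_$_; _∘_)
open import Function.Bundles using (Equivalence)
open import Relation.Binary.Definitions using (WeaklyDecidable)
open import Relation.Binary.PropositionalEquality
open import Relation.Binary.Structures using (IsDecTotalOrder)
open import Relation.Nullary.Decidable using (Dec; yes; no; ⌊_⌋)
open import Relation.Nullary.Negation.Core using (¬_; contradiction)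

-- Ordered fields

module OrderedField (ℛ : RealNumbers) where
  open RealNumbers ℛ public
  open CommutativeRing commutativeRing public
    using (ring; semiring; +-commutativeMonoid; +-identityˡ; +-identityʳ; +-comm; +-assoc;
           *-identityˡ; *-identityʳ; *-comm; *-assoc; distribˡ; distribʳ; zeroˡ; zeroʳ; -‿inverseʳ)
  open RingProperties ring public using (-‿distribˡ-*; -‿distribʳ-*; -‿involutive; -0#≈0#; -‿+-comm)
  open CommutativeMonoidSum +-commutativeMonoid public using (∑-comm; ∑-distrib-+; sum-cong-≗)
  open SemiringSum semiring public using (*-distribˡ-sum)
  open IsDecTotalOrder isDecTotalOrder public
    using () renaming (refl to ≤-refl; trans to ≤-trans; antisym to ≤-antisym; total to ≤-total;
                       reflexive to ≤-reflexive)

  fromℕ-+ : ∀ m n → fromℕ (m ℕ.+ n) ≡ fromℕ m + fromℕ n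
  fromℕ-+ zero    n = sym (+-identityˡ _)
  fromℕ-+ (suc m) n = trans (cong (1# +_) (fromℕ-+ m n)) (sym (+-assoc _ _ _))

  fromℕ-* : ∀ m n → fromℕ (m ℕ.* n) ≡ fromℕ m * fromℕ n
  fromℕ-* zero    n = sym (zeroˡ _)
  fromℕ-* (suc m) n = begin
    fromℕ (n ℕ.+ m ℕ.* n)              ≡⟨ fromℕ-+ n (m ℕ.* n) ⟩
    fromℕ n + fromℕ (m ℕ.* n)          ≡⟨ cong₂ _+_ (sym (*-identityˡ _)) (fromℕ-* m n) ⟩
    1# * fromℕ n + fromℕ m * fromℕ n   ≡⟨ distribʳ _ _ _ ⟨
    (1# + fromℕ m) * fromℕ n           ∎
    where open ≡-Reasoning

  -- Integer coefficients for the ring solver.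

  private
    ⟦_⟧ : ℤ → ℝ
    ⟦ pos n ⟧      = fromℕ n
    ⟦ negsuc n ⟧ = - fromℕ (suc n)

    ⟦⟧-⊖ : ∀ m n → ⟦ m ℤ.⊖ n ⟧ ≡ fromℕ m − fromℕ n
    ⟦⟧-⊖ m zero          = trans (sym (+-identityʳ _)) (cong (fromℕ m +_) (sym -0#≈0#))
    ⟦⟧-⊖ zero (suc n)    = sym (+-identityˡ _)
    ⟦⟧-⊖ (suc m) (suc n) = begin
      ⟦ suc m ℤ.⊖ suc n ⟧                      ≡⟨ cong ⟦_⟧ (ℤ.[1+m]⊖[1+n]≡m⊖n m n) ⟩
      ⟦ m ℤ.⊖ n ⟧                              ≡⟨ ⟦⟧-⊖ m n ⟩
      fromℕ m − fromℕ n                        ≡⟨ +-identityʳ _ ⟨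
      fromℕ m − fromℕ n + 0#                   ≡⟨ cong (fromℕ m − fromℕ n +_) (-‿inverseʳ 1#) ⟨
      fromℕ m − fromℕ n + (1# − 1#)            ≡⟨ +-assoc _ _ _ ⟩
      fromℕ m + (- fromℕ n + (1# − 1#))        ≡⟨ cong (fromℕ m +_) (+-assoc _ _ _) ⟨
      fromℕ m + (- fromℕ n + 1# − 1#)          ≡⟨ cong (λ x → fromℕ m + (x − 1#)) (+-comm _ _) ⟩
      fromℕ m + (1# − fromℕ n − 1#)            ≡⟨ cong (fromℕ m +_) (+-assoc _ _ _) ⟩
      fromℕ m + (1# + (- fromℕ n − 1#))        ≡⟨ +-assoc _ _ _ ⟨
      fromℕ m + 1# + (- fromℕ n − 1#)          ≡⟨ cong₂ _+_ (+-comm _ _) (+-comm _ _) ⟩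
      1# + fromℕ m + (- 1# − fromℕ n)          ≡⟨ cong (1# + fromℕ m +_) (-‿+-comm _ _) ⟩
      fromℕ (suc m) − fromℕ (suc n)            ∎
      where open ≡-Reasoning

    ⟦⟧-+ : ∀ i j → ⟦ i ℤ.+ j ⟧ ≡ ⟦ i ⟧ + ⟦ j ⟧
    ⟦⟧-+ (pos m)      (pos n)      = fromℕ-+ m n
    ⟦⟧-+ (pos m)      (negsuc n)   = ⟦⟧-⊖ m (suc n)
    ⟦⟧-+ (negsuc m)   (pos n)      = trans (⟦⟧-⊖ n (suc m)) (+-comm _ _)
    ⟦⟧-+ (negsuc m)   (negsuc n)   = begin
      - fromℕ (suc (suc (m ℕ.+ n)))        ≡⟨ cong (-_ ∘ fromℕ ∘ suc) (ℕ.+-suc m n) ⟨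
      - fromℕ (suc m ℕ.+ suc n)            ≡⟨ cong -_ (fromℕ-+ (suc m) (suc n)) ⟩
      - (fromℕ (suc m) + fromℕ (suc n))    ≡⟨ -‿+-comm _ _ ⟨
      - fromℕ (suc m) − fromℕ (suc n)      ∎
      where open ≡-Reasoning

    ⟦⟧-neg : ∀ i → ⟦ ℤ.- i ⟧ ≡ - ⟦ i ⟧
    ⟦⟧-neg (pos zero)  = sym -0#≈0#
    ⟦⟧-neg (pos (suc n)) = refl
    ⟦⟧-neg (negsuc n)  = sym (-‿involutive _)

    ⟦⟧-pos-* : ∀ m n → ⟦ pos m ℤ.* pos n ⟧ ≡ fromℕ m * fromℕ n
    ⟦⟧-pos-* m n = trans (cong ⟦_⟧ (sym (ℤ.pos-* m n))) (fromℕ-* m n)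

    ⟦⟧-posˡ-* : ∀ m j → ⟦ pos m ℤ.* j ⟧ ≡ fromℕ m * ⟦ j ⟧
    ⟦⟧-posˡ-* m (pos n)    = ⟦⟧-pos-* m n
    ⟦⟧-posˡ-* m (negsuc n) = begin
      ⟦ pos m ℤ.* ℤ.- (pos (suc n)) ⟧        ≡⟨ cong ⟦_⟧ (ℤ.neg-distribʳ-* (pos m) (pos (suc n))) ⟨
      ⟦ ℤ.- (pos m ℤ.* pos (suc n)) ⟧        ≡⟨ ⟦⟧-neg (pos m ℤ.* pos (suc n)) ⟩
      - ⟦ pos m ℤ.* pos (suc n) ⟧            ≡⟨ cong -_ (⟦⟧-pos-* m (suc n)) ⟩
      - (fromℕ m * fromℕ (suc n))      ≡⟨ -‿distribʳ-* _ _ ⟩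
      fromℕ m * - fromℕ (suc n)        ∎
      where open ≡-Reasoning

    ⟦⟧-* : ∀ i j → ⟦ i ℤ.* j ⟧ ≡ ⟦ i ⟧ * ⟦ j ⟧
    ⟦⟧-* (pos m)    j = ⟦⟧-posˡ-* m j
    ⟦⟧-* (negsuc m) j = begin
      ⟦ ℤ.- (pos (suc m)) ℤ.* j ⟧      ≡⟨ cong ⟦_⟧ (ℤ.neg-distribˡ-* (pos (suc m)) j) ⟨
      ⟦ ℤ.- (pos (suc m) ℤ.* j) ⟧      ≡⟨ ⟦⟧-neg (pos (suc m) ℤ.* j) ⟩
      - ⟦ pos (suc m) ℤ.* j ⟧          ≡⟨ cong -_ (⟦⟧-posˡ-* (suc m) j) ⟩
      - (fromℕ (suc m) * ⟦ j ⟧)    ≡⟨ -‿distribˡ-* _ _ ⟩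
      - fromℕ (suc m) * ⟦ j ⟧      ∎
      where open ≡-Reasoning

    -- fromℕ 1 is 1# + 0#, so 1 needs a clause of its own for con (pos 1) to denote 1#.
    ⟦_⟧₁ : ℤ → ℝ
    ⟦ pos 1 ⟧₁ = 1#
    ⟦ i   ⟧₁ = ⟦ i ⟧

    ⟦⟧₁≡⟦⟧ : ∀ i → ⟦ i ⟧₁ ≡ ⟦ i ⟧
    ⟦⟧₁≡⟦⟧ (pos 0)           = refl
    ⟦⟧₁≡⟦⟧ (pos 1)           = sym (+-identityʳ 1#)
    ⟦⟧₁≡⟦⟧ (pos (suc (suc n))) = refl
    ⟦⟧₁≡⟦⟧ (negsuc n)        = refl

    morphism : ℤ.+-*-rawRing -Raw-AlmostCommutative⟶ fromCommutativeRing commutativeRing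
    morphism = record
      { ⟦_⟧    = ⟦_⟧₁
      ; +-homo = λ i j → trans (⟦⟧₁≡⟦⟧ (i ℤ.+ j)) (trans (⟦⟧-+ i j) (sym (cong₂ _+_ (⟦⟧₁≡⟦⟧ i) (⟦⟧₁≡⟦⟧ j))))
      ; *-homo = λ i j → trans (⟦⟧₁≡⟦⟧ (i ℤ.* j)) (trans (⟦⟧-* i j) (sym (cong₂ _*_ (⟦⟧₁≡⟦⟧ i) (⟦⟧₁≡⟦⟧ j))))
      ; -‿homo = λ i → trans (⟦⟧₁≡⟦⟧ (ℤ.- i)) (trans (⟦⟧-neg i) (cong -_ (sym (⟦⟧₁≡⟦⟧ i))))
      ; 0-homo = refl
      ; 1-homo = refl
      }

    ⟦⟧₁-≟ : WeaklyDecidable (λ i j → ⟦ i ⟧₁ ≡ ⟦ j ⟧₁)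
    ⟦⟧₁-≟ i j with i ℤ.≟ j
    ... | yes i≡j = just (cong ⟦_⟧₁ i≡j)
    ... | no  _   = nothing

  -- The coefficients are integers because integer arithmetic evaluates while the reals are
  -- abstract; numerals then cancel by computation.
  module Solver = RingSolver ℤ.+-*-rawRing (fromCommutativeRing commutativeRing) morphism ⟦⟧₁-≟
  open Solver using (solve; _:=_; _:+_; _:*_; _:-_; :-_; con)

  -- Order, cancellation and inverses.

  ≤⇒0≤− : ∀ {x y} → x ≤ y → 0# ≤ y − x
  ≤⇒0≤− {x} x≤y = subst (_≤ _) (-‿inverseʳ x) (+-monoˡ-≤ (- x) x≤y)

  0≤−⇒≤ : ∀ {x y} → 0# ≤ y − x → x ≤ y
  0≤−⇒≤ {x} {y} 0≤y−x = subst₂ _≤_ (+-identityˡ x)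
    (solve 2 (λ x y → y :- x :+ x := y) refl x y) (+-monoˡ-≤ x 0≤y−x)

  +-nonneg : ∀ {x y} → 0# ≤ x → 0# ≤ y → 0# ≤ x + y
  +-nonneg {x} {y} 0≤x 0≤y = ≤-trans 0≤y (subst (_≤ x + y) (+-identityˡ y) (+-monoˡ-≤ y 0≤x))

  +-mono-≤ : ∀ {w x y z} → w ≤ x → y ≤ z → w + y ≤ x + z
  +-mono-≤ {w} {x} {y} {z} w≤x y≤z = 0≤−⇒≤ $ subst (0# ≤_)
    (solve 4 (λ w x y z → x :- w :+ (z :- y) := x :+ z :- (w :+ y)) refl w x y z)
    (+-nonneg (≤⇒0≤− w≤x) (≤⇒0≤− y≤z))

  *-monoˡ-≤ : ∀ {x y z} → 0# ≤ z → x ≤ y → z * x ≤ z * y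
  *-monoˡ-≤ {x} {y} {z} 0≤z x≤y = 0≤−⇒≤ $ subst (0# ≤_)
    (solve 3 (λ x y z → z :* (y :- x) := z :* y :- z :* x) refl x y z)
    (*-nonneg 0≤z (≤⇒0≤− x≤y))

  *-monoʳ-≤ : ∀ {x y z} → 0# ≤ z → x ≤ y → x * z ≤ y * z
  *-monoʳ-≤ 0≤z x≤y = subst₂ _≤_ (*-comm _ _) (*-comm _ _) (*-monoˡ-≤ 0≤z x≤y)

  0≤1 : 0# ≤ 1#
  0≤1 = [ (λ 0≤1 → 0≤1) , (λ 1≤0 → let 0≤-1 = ≤⇒0≤− 1≤0 in
    subst (0# ≤_) (solve 0 ((con (pos 0) :- con (pos 1)) :* (con (pos 0) :- con (pos 1)) := con (pos 1)) refl)
      (*-nonneg 0≤-1 0≤-1)) ]′ (≤-total 0# 1#)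

  0≤fromℕ : ∀ n → 0# ≤ fromℕ n
  0≤fromℕ zero    = ≤-refl
  0≤fromℕ (suc n) = +-nonneg 0≤1 (0≤fromℕ n)

  fromℕ-mono-≤ : ∀ {m n} → m ℕ.≤ n → fromℕ m ≤ fromℕ n
  fromℕ-mono-≤ {n = n} z≤n = 0≤fromℕ n
  fromℕ-mono-≤ (s≤s m≤n) = +-mono-≤ ≤-refl (fromℕ-mono-≤ m≤n)

  +-pos-nonneg : ∀ {x y} → 0# < x → 0# ≤ y → 0# < x + y
  +-pos-nonneg {x} {y} (0≤x , 0≢x) 0≤y =
    +-nonneg 0≤x 0≤y , λ 0≡x+y → 0≢x $ ≤-antisym 0≤x $
      subst₂ _≤_ (+-identityʳ x) (sym 0≡x+y) (+-mono-≤ ≤-refl 0≤y)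

  0<fromℕ-suc : ∀ n → 0# < fromℕ (suc n)
  0<fromℕ-suc n = +-pos-nonneg (0≤1 , 0≢1) (0≤fromℕ n)

  *-cancelˡ-≡ : ∀ {z x y} → 0# ≢ z → z * x ≡ z * y → x ≡ y
  *-cancelˡ-≡ {z} {x} {y} 0≢z zx≡zy = begin
    x                ≡⟨ *-identityˡ x ⟨
    1# * x           ≡⟨ cong (_* x) (*-inverseʳ z (0≢z ∘ sym)) ⟨
    z * z ⁻¹ * x     ≡⟨ solve 3 (λ z z⁻¹ x → z :* z⁻¹ :* x := z⁻¹ :* (z :* x)) refl z (z ⁻¹) x ⟩
    z ⁻¹ * (z * x)   ≡⟨ cong (z ⁻¹ *_) zx≡zy ⟩
    z ⁻¹ * (z * y)   ≡⟨ solve 3 (λ z z⁻¹ x → z :* z⁻¹ :* x := z⁻¹ :* (z :* x)) refl z (z ⁻¹) y ⟨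
    z * z ⁻¹ * y     ≡⟨ cong (_* y) (*-inverseʳ z (0≢z ∘ sym)) ⟩
    1# * y           ≡⟨ *-identityˡ y ⟩
    y                ∎
    where open ≡-Reasoning

  *-cancelˡ-≤ : ∀ {z x y} → 0# < z → z * x ≤ z * y → x ≤ y
  *-cancelˡ-≤ {z} {x} {y} (0≤z , 0≢z) zx≤zy with ≤-total x y
  ... | inj₁ x≤y = x≤y
  -- Multiplying `y≤x` by `z` gives the reverse inequality, so the two products are equal and `z`
  -- cancels.
  ... | inj₂ y≤x = ≤-reflexive (*-cancelˡ-≡ 0≢z (≤-antisym zx≤zy (*-monoˡ-≤ 0≤z y≤x)))

  ⁻¹-nonneg : ∀ {x} → 0# < x → 0# ≤ x ⁻¹
  ⁻¹-nonneg {x} 0<x@(_ , 0≢x) = *-cancelˡ-≤ 0<x $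
    subst₂ _≤_ (sym (zeroʳ x)) (sym (*-inverseʳ x (0≢x ∘ sym))) 0≤1

  ⁻¹-pos : ∀ {x} → 0# < x → 0# < x ⁻¹
  ⁻¹-pos {x} 0<x@(_ , 0≢x) = ⁻¹-nonneg 0<x , λ 0≡x⁻¹ → 0≢1 $
    trans (sym (zeroʳ x)) (trans (cong (x *_) 0≡x⁻¹) (*-inverseʳ x (0≢x ∘ sym)))

  *-pos : ∀ {x y} → 0# < x → 0# < y → 0# < x * y
  *-pos {x} (0≤x , 0≢x) (0≤y , 0≢y) = *-nonneg 0≤x 0≤y , λ 0≡xy → 0≢y (*-cancelˡ-≡ 0≢x (trans (zeroʳ x) 0≡xy))

  *-/-cancel : ∀ {x y} → 0# ≢ y → y * (x / y) ≡ x
  *-/-cancel {x} {y} 0≢y = begin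
    y * (x * y ⁻¹)   ≡⟨ solve 3 (λ x y z → y :* (x :* z) := x :* (y :* z)) refl x y (y ⁻¹) ⟩
    x * (y * y ⁻¹)   ≡⟨ cong (x *_) (*-inverseʳ y (0≢y ∘ sym)) ⟩
    x * 1#           ≡⟨ *-identityʳ x ⟩
    x                ∎
    where open ≡-Reasoning

  ≰⇒≥ : ∀ {x y} → ¬ (x ≤ y) → y ≤ x
  ≰⇒≥ {x} {y} x≰y with ≤-total x y
  ... | inj₁ x≤y = contradiction x≤y x≰y
  ... | inj₂ y≤x = y≤x

  sum-mono-≤ : ∀ {n} {f g : Fin n → ℝ} → (∀ i → f i ≤ g i) → sum f ≤ sum g
  sum-mono-≤ {zero}  f≤g = ≤-refl
  sum-mono-≤ {suc n} f≤g = +-mono-≤ (f≤g zero) (sum-mono-≤ (f≤g ∘ suc))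

  sum-nonneg : ∀ {n} {f : Fin n → ℝ} → (∀ i → 0# ≤ f i) → 0# ≤ sum f
  sum-nonneg {zero}  0≤f = ≤-refl
  sum-nonneg {suc n} 0≤f = +-nonneg (0≤f zero) (sum-nonneg (0≤f ∘ suc))

-- The dual certificate

-- All three are in units of 1/200. The end classes 0 and 101 hold the biases up to 1/4 and from 3/4
-- on, with probabilities 0 (by truncated subtraction) and 1. In between, `selection` takes at the
-- middle of each class the value of the line running from 0 at bias 1/4 to 1 at bias 3/4.
lower upper selection : ℕ → ℕ
lower zero    = 0
lower (suc k) = 50 ℕ.+ k
upper k       = if k <ᵇ 101 then 50 ℕ.+ k else 200
selection k   = if k <ᵇ 101 then 2 ℕ.* k ∸ 1 else 200

-- Reversing all arcs maps class k to class 101 - k and swaps the sides; 159 = 6 * 101 - 447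
-- makes the multipliers invariant up to sign.  The value 447 comes from the optimal dual solution, in which
-- 595 times the multiplier of class k is close to 6k - 447 (and 119 = 595 / 5 below).
pivot : Bool → ℕ
pivot true  = 447
pivot false = 159

-- Truncated subtraction splits the multiplier z into its negative part `pivot a ∸ 6 ℕ.* i` and its
-- positive part `6 ℕ.* i ∸ pivot a`, at most one of them non-zero. The first multiplies the upper
-- bias bound, the second the lower one. "Gain" collects the coefficients on the smaller side of the
-- weighted bounds, "loss" those on the larger side, so everything stays in the natural numbers.
outGain outLoss inGain inLoss : Bool → ℕ → ℕ
outGain a i = (pivot a ∸ 6 ℕ.* i) ℕ.* (200 ∸ upper i)
inLoss  a i = (pivot a ∸ 6 ℕ.* i) ℕ.* upper i
outLoss a i = (6 ℕ.* i ∸ pivot a) ℕ.* (200 ∸ lower i)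
inGain  a i = (6 ℕ.* i ∸ pivot a) ℕ.* lower i

crossing : Bool → Bool → ℕ
crossing a b = if a ∧ not b then 1 else 0

-- 19320 is 0.483 * 200².
arcCost arcValue : Bool → Bool → ℕ → ℕ → ℕ
arcCost  a b i j = 119 ℕ.* 19320 ℕ.* crossing a b ℕ.+ 40 ℕ.* (outLoss a i ℕ.+ inLoss b j)
arcValue a b i j = 119 ℕ.* (selection i ℕ.* (200 ∸ selection j)) ℕ.+ 40 ℕ.* (outGain a i ℕ.+ inGain b j)

-- This is the dual constraint of a single arc, multiplied by 119 · 200². A multiplier z / 595
-- applied to a bias bound n / 200 then turns into 40 · z · n, which explains the factor 40.
arcCheck : Bool → Bool → ℕ → ℕ → Bool
arcCheck a b i j = arcCost a b i j ℕ.≤ᵇ arcValue a b i j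

-- Once both sides are literals the term is closed, and `refl` evaluates all 102² comparisons.
arcChecked : ∀ a b → all (λ i → all (arcCheck a b i) (upTo 102)) (upTo 102) ≡ true
arcChecked true  true  = refl
arcChecked true  false = refl
arcChecked false true  = refl
arcChecked false false = refl

arcCost≤arcValue : ∀ a b {i} → i ℕ.< 102 → ∀ {j} → j ℕ.< 102 → arcCost a b i j ℕ.≤ arcValue a b i j
arcCost≤arcValue a b {i} i<102 {j} j<102 = ℕ.≤ᵇ⇒≤ (arcCost a b i j) (arcValue a b i j) $
  All.lookup (all⁺ (arcCheck a b i) (upTo 102) row) (∈-upTo⁺ j<102)
  where
  row : T (all (arcCheck a b i) (upTo 102))
  row = All.lookup (all⁺ (λ i → all (arcCheck a b i) (upTo 102)) (upTo 102)
    (subst T (sym (arcChecked a b)) _)) (∈-upTo⁺ i<102)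

selection≤200 : ∀ k → selection k ℕ.≤ 200
selection≤200 k with k <ᵇ 101 in k<ᵇ101
... | false = ℕ.≤-refl
... | true  = ℕ.≤-trans (ℕ.m∸n≤m (2 ℕ.* k) 1) (ℕ.*-monoʳ-≤ 2 (ℕ.≤-pred (ℕ.<ᵇ⇒< k 101 (subst T (sym k<ᵇ101) _))))

selection-mono : ∀ {i j} → i ℕ.≤ j → selection i ℕ.≤ selection j
selection-mono {i} {j} i≤j with j <ᵇ 101 in j<ᵇ101
... | false = selection≤200 i
... | true  = subst (λ b → (if b then 2 ℕ.* i ∸ 1 else 200) ℕ.≤ 2 ℕ.* j ∸ 1) (sym i<ᵇ101)
  (ℕ.∸-monoˡ-≤ 1 (ℕ.*-monoʳ-≤ 2 i≤j))
  where
  i<ᵇ101 : (i <ᵇ 101) ≡ true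
  i<ᵇ101 = Equivalence.to T-≡ (ℕ.<⇒<ᵇ (ℕ.≤-<-trans i≤j (ℕ.<ᵇ⇒< j 101 (subst T (sym j<ᵇ101) _))))

-- From the arc inequalities to the inequality between cut and value.

module Bias (ℛ : RealNumbers) where
  open OrderedField ℛ
  open Solver using (solve; _:=_; _:+_; _:*_; _:-_; :-_; con)

  fromℕ-∸ : ∀ {m n} → n ℕ.≤ m → fromℕ (m ∸ n) ≡ fromℕ m − fromℕ n
  fromℕ-∸ {m} {n} n≤m = begin
    fromℕ (m ∸ n)                        ≡⟨ solve 2 (λ x y → x := x :+ y :- y) refl _ (fromℕ n) ⟩
    fromℕ (m ∸ n) + fromℕ n − fromℕ n    ≡⟨ cong (_− fromℕ n) (fromℕ-+ (m ∸ n) n) ⟨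
    fromℕ (m ∸ n ℕ.+ n) − fromℕ n        ≡⟨ cong (λ k → fromℕ k − fromℕ n) (ℕ.m∸n+n≡m n≤m) ⟩
    fromℕ m − fromℕ n                    ∎
    where open ≡-Reasoning

  module Weighted {n} (W : Fin n → Fin n → ℝ) where

    total : (Fin n → Fin n → ℝ) → ℝ
    total φ = sum λ u → sum λ v → W u v * φ u v

    outWeight inWeight : Fin n → ℝ
    outWeight u = sum λ v → W u v
    inWeight  v = sum λ u → W u v

    total-cong : ∀ {φ ψ} → (∀ u v → φ u v ≡ ψ u v) → total φ ≡ total ψ
    total-cong φ≡ψ = sum-cong-≗ λ u → sum-cong-≗ λ v → cong (W u v *_) (φ≡ψ u v)

    total-+ : ∀ φ ψ → total (λ u v → φ u v + ψ u v) ≡ total φ + total ψ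
    total-+ φ ψ = trans
      (sum-cong-≗ λ u → trans (sum-cong-≗ λ v → distribˡ (W u v) (φ u v) (ψ u v))
        (∑-distrib-+ (λ v → W u v * φ u v) (λ v → W u v * ψ u v)))
      (∑-distrib-+ (λ u → sum λ v → W u v * φ u v) (λ u → sum λ v → W u v * ψ u v))

    total-* : ∀ c φ → total (λ u v → c * φ u v) ≡ c * total φ
    total-* c φ = sym $ trans (*-distribˡ-sum c (λ u → sum λ v → W u v * φ u v)) $
      sum-cong-≗ λ u → trans (*-distribˡ-sum c (λ v → W u v * φ u v)) $
      sum-cong-≗ λ v → solve 3 (λ c w x → c :* (w :* x) := w :* (c :* x)) refl c (W u v) (φ u v)

    -- Grouping arcs by their tail, and in `total-target` by their head, converts charges on arcs
    -- into charges on nodes. This is where the bias constraints, which concern nodes, meet the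
    -- inequalities on arcs.
    total-source : (a : Fin n → ℝ) → total (λ u v → a u) ≡ sum λ u → a u * outWeight u
    total-source a = sum-cong-≗ λ u → trans (sum-cong-≗ λ v → *-comm (W u v) (a u))
      (sym (*-distribˡ-sum (a u) (λ v → W u v)))

    total-target : (b : Fin n → ℝ) → total (λ u v → b v) ≡ sum λ v → b v * inWeight v
    total-target b = trans (∑-comm (λ u v → W u v * b v)) $ sum-cong-≗ λ v →
      trans (sum-cong-≗ λ u → *-comm (W u v) (b v)) (sym (*-distribˡ-sum (b v) (λ u → W u v)))

    total-mono-≤ : (∀ u v → 0# ≤ W u v) → ∀ {φ ψ} → (∀ u v → φ u v ≤ ψ u v) → total φ ≤ total ψ
    total-mono-≤ 0≤W φ≤ψ = sum-mono-≤ λ u → sum-mono-≤ λ v → *-monoˡ-≤ (0≤W u v) (φ≤ψ u v)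

  -- lower k / 200 ≤ out / (out + inn) ≤ upper k / 200, with denominators cleared and the
  -- common part of both sides cancelled.
  InClass : ℕ → ℝ → ℝ → Set
  InClass k out inn =
    fromℕ (lower k) * inn ≤ fromℕ (200 ∸ lower k) * out ×
    fromℕ (200 ∸ upper k) * out ≤ fromℕ (upper k) * inn

  -- The two bounds of `InClass` are multiplied by the negative and the positive part of the
  -- multiplier and added.
  gain≤loss : ∀ a {k out inn} → InClass k out inn →
              fromℕ (outGain a k) * out + fromℕ (inGain a k) * inn ≤
              fromℕ (outLoss a k) * out + fromℕ (inLoss a k) * inn
  gain≤loss a {k} {out} {inn} (≤lower , upper≤) = subst₂ _≤_
    (cong₂ _+_ (regroup (pivot a ∸ 6 ℕ.* k) (200 ∸ upper k) out) (regroup (6 ℕ.* k ∸ pivot a) (lower k) inn))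
    (trans (+-comm _ _) (cong₂ _+_ (regroup (6 ℕ.* k ∸ pivot a) (200 ∸ lower k) out) (regroup (pivot a ∸ 6 ℕ.* k) (upper k) inn)))
    (+-mono-≤ (*-monoˡ-≤ (0≤fromℕ (pivot a ∸ 6 ℕ.* k)) upper≤)
              (*-monoˡ-≤ (0≤fromℕ (6 ℕ.* k ∸ pivot a)) ≤lower))
    where
    regroup : ∀ m n x → fromℕ m * (fromℕ n * x) ≡ fromℕ (m ℕ.* n) * x
    regroup m n x = trans (sym (*-assoc _ _ _)) (cong (_* x) (sym (fromℕ-* m n)))

  module _ {n} (W : Fin n → Fin n → ℝ) (0≤W : ∀ u v → 0# ≤ W u v)
           (class : Fin n → ℕ) (class<102 : ∀ v → class v ℕ.< 102)
           (inClass : ∀ v → InClass (class v) (Weighted.outWeight W v) (Weighted.inWeight W v))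
           (side : Fin n → Bool) where
    open Weighted W

    private
      -- `arcCost` and `arcValue` both have the shape α χ + β (a + b) with a depending on the tail
      -- and b on the head, so one summation serves both sides.
      combination : ∀ α β (χ : Fin n → Fin n → ℕ) (a b : Fin n → ℕ) →
        total (λ u v → fromℕ (α ℕ.* χ u v ℕ.+ β ℕ.* (a u ℕ.+ b v))) ≡
        fromℕ α * total (λ u v → fromℕ (χ u v)) +
        fromℕ β * sum (λ v → fromℕ (a v) * outWeight v + fromℕ (b v) * inWeight v)
      combination α β χ a b = begin
        total (λ u v → fromℕ (α ℕ.* χ u v ℕ.+ β ℕ.* (a u ℕ.+ b v)))
          ≡⟨ total-cong (λ u v → trans (fromℕ-+ (α ℕ.* χ u v) _) (cong₂ _+_ (fromℕ-* α _)
               (trans (fromℕ-* β _) (cong (fromℕ β *_) (fromℕ-+ (a u) (b v)))))) ⟩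
        total (λ u v → fromℕ α * fromℕ (χ u v) + fromℕ β * (fromℕ (a u) + fromℕ (b v)))
          ≡⟨ total-+ (λ u v → fromℕ α * fromℕ (χ u v)) (λ u v → fromℕ β * (fromℕ (a u) + fromℕ (b v))) ⟩
        total (λ u v → fromℕ α * fromℕ (χ u v)) + total (λ u v → fromℕ β * (fromℕ (a u) + fromℕ (b v)))
          ≡⟨ cong₂ _+_ (total-* (fromℕ α) (λ u v → fromℕ (χ u v))) (total-* (fromℕ β) (λ u v → fromℕ (a u) + fromℕ (b v))) ⟩
        fromℕ α * total (λ u v → fromℕ (χ u v)) + fromℕ β * total (λ u v → fromℕ (a u) + fromℕ (b v))
          ≡⟨ cong (λ x → fromℕ α * total (λ u v → fromℕ (χ u v)) + fromℕ β * x) (begin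
               total (λ u v → fromℕ (a u) + fromℕ (b v))
                 ≡⟨ total-+ (λ u v → fromℕ (a u)) (λ u v → fromℕ (b v)) ⟩
               total (λ u v → fromℕ (a u)) + total (λ u v → fromℕ (b v))
                 ≡⟨ cong₂ _+_ (total-source (λ u → fromℕ (a u))) (total-target (λ v → fromℕ (b v))) ⟩
               sum (λ u → fromℕ (a u) * outWeight u) + sum (λ v → fromℕ (b v) * inWeight v)
                 ≡⟨ ∑-distrib-+ (λ u → fromℕ (a u) * outWeight u) (λ v → fromℕ (b v) * inWeight v) ⟨
               sum (λ v → fromℕ (a v) * outWeight v + fromℕ (b v) * inWeight v) ∎) ⟩
        fromℕ α * total (λ u v → fromℕ (χ u v)) +
        fromℕ β * sum (λ v → fromℕ (a v) * outWeight v + fromℕ (b v) * inWeight v) ∎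
        where open ≡-Reasoning

      crossingArc valueArc : Fin n → Fin n → ℕ
      crossingArc u v = crossing (side u) (side v)
      valueArc    u v = selection (class u) ℕ.* (200 ∸ selection (class v))

      gain loss : ℝ
      gain = sum λ v → fromℕ (outGain (side v) (class v)) * outWeight v + fromℕ (inGain (side v) (class v)) * inWeight v
      loss = sum λ v → fromℕ (outLoss (side v) (class v)) * outWeight v + fromℕ (inLoss (side v) (class v)) * inWeight v

      cost≤value : fromℕ (119 ℕ.* 19320) * total (λ u v → fromℕ (crossingArc u v)) + fromℕ 40 * loss ≤
                   fromℕ 119 * total (λ u v → fromℕ (valueArc u v)) + fromℕ 40 * gain
      cost≤value = subst₂ _≤_
        (combination (119 ℕ.* 19320) 40 crossingArc (λ u → outLoss (side u) (class u)) (λ v → inLoss (side v) (class v)))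
        (combination 119 40 valueArc (λ u → outGain (side u) (class u)) (λ v → inGain (side v) (class v)))
        (total-mono-≤ 0≤W λ u v → fromℕ-mono-≤ (arcCost≤arcValue (side u) (side v) (class<102 u) (class<102 v)))

      cut value : ℝ
      cut   = total λ u v → fromℕ (crossingArc u v)
      value = total λ u v → fromℕ (valueArc u v)

    scaledCut≤scaledValue : fromℕ 19320 * total (λ u v → fromℕ (crossing (side u) (side v))) ≤
                            total (λ u v → fromℕ (selection (class u) ℕ.* (200 ∸ selection (class v))))
    scaledCut≤scaledValue = *-cancelˡ-≤ (0<fromℕ-suc 118) $ 0≤−⇒≤ $ subst (0# ≤_)
      -- The variables are 119, 40, 19320, cut, value, gain and loss. The difference to be shown
      -- nonnegative is the slack of the summed arc inequality plus 40 times `loss − gain`.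
      (solve 7 (λ k l m x y g h → (k :* y :+ l :* g :- (k :* m :* x :+ l :* h)) :+ l :* (h :- g) := k :* y :- k :* (m :* x))
        refl (fromℕ 119) (fromℕ 40) (fromℕ 19320) cut value gain loss)
      (+-nonneg
        (≤⇒0≤− (subst (λ c → c * cut + fromℕ 40 * loss ≤ fromℕ 119 * value + fromℕ 40 * gain) (fromℕ-* 119 19320) cost≤value))
        (*-nonneg (0≤fromℕ 40) (≤⇒0≤− (sum-mono-≤ λ v → gain≤loss (side v) {class v} (inClass v)))))

-- Expectation of multi-affine functions of the draws

infixl 5 _[_≔_]
_[_≔_] : ∀ {m} {A : Set} → (Fin m → A) → Fin m → A → Fin m → A
(y [ u ≔ p ]) v = if ⌊ v ≟ u ⌋ then p else y v

module Expectation (ℛ : RealNumbers) where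
  open OrderedField ℛ
  open Solver using (solve; _:=_; _:+_; _:*_; _:-_; :-_; con)
  open Dicut ℛ
  open UnitReal

  indicator : Bool → ℝ
  indicator b = if b then 1# else 0#

  0≤indicator : ∀ b → 0# ≤ indicator b
  0≤indicator true  = 0≤1
  0≤indicator false = ≤-refl

  indicator≤1 : ∀ b → indicator b ≤ 1#
  indicator≤1 true  = ≤-refl
  indicator≤1 false = 0≤1

  riemannSum-nonneg : ∀ {h δ a b} → (∀ t → 0# ≤ h t) → (P : Partition δ a b) → 0# ≤ riemannSum h P
  riemannSum-nonneg 0≤h done                    = ≤-refl
  riemannSum-nonneg 0≤h (cell t a≤t t≤c _ rest) =
    +-nonneg (*-nonneg (0≤h t) (≤⇒0≤− (≤-trans a≤t t≤c))) (riemannSum-nonneg 0≤h rest)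

  -- Integration of step functions.

  module StepFunction (x : ℝ) where

    χ : UnitReal → ℝ
    χ t = indicator ⌊ value t ≤? x ⌋

    step-beyond : ∀ {δ a b} → ¬ a ≤ x → (P : Partition δ a b) → riemannSum χ P ≡ 0#
    step-beyond a≰x done = refl
    step-beyond {a = a} a≰x (cell {c = c} t a≤t t≤c _ rest)
      with value t ≤? x
    ... | yes t≤x = contradiction (≤-trans a≤t t≤x) a≰x
    ... | no  t≰x = trans
      (cong (0# * (c − a) +_) (step-beyond (λ c≤x → a≰x (≤-trans a≤t (≤-trans t≤c c≤x))) rest))
      (trans (+-identityʳ _) (zeroˡ _))

    -- Cells ending at or before `x` contribute at most their length, and cells starting after `x`
    -- contribute nothing. Only a cell straddling `x` can overshoot, by at most the mesh δ.
    step-upper : ∀ {δ a b} → 0# ≤ δ → a ≤ x → (P : Partition δ a b) → riemannSum χ P ≤ x − a + δ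
    step-upper 0≤δ a≤x done = +-nonneg (≤⇒0≤− a≤x) 0≤δ
    step-upper {δ} {a} 0≤δ a≤x (cell {c = c} t a≤t t≤c c−a≤δ rest) with c ≤? x
    ... | yes c≤x = subst (χ t * (c − a) + riemannSum χ rest ≤_)
      (solve 4 (λ x a c δ → con (pos 1) :* (c :- a) :+ (x :- c :+ δ) := x :- a :+ δ) refl x a c δ)
      (+-mono-≤ (*-monoʳ-≤ (≤⇒0≤− (≤-trans a≤t t≤c)) (indicator≤1 ⌊ value t ≤? x ⌋)) (step-upper 0≤δ c≤x rest))
    ... | no  c≰x = subst₂ _≤_ (cong (χ t * (c − a) +_) (sym (step-beyond c≰x rest)))
      (solve 3 (λ x a δ → con (pos 1) :* δ :+ (x :- a) := x :- a :+ δ) refl x a δ)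
      (+-mono-≤ (≤-trans (*-monoʳ-≤ (≤⇒0≤− (≤-trans a≤t t≤c)) (indicator≤1 ⌊ value t ≤? x ⌋))
                         (*-monoˡ-≤ 0≤1 c−a≤δ))
                (≤⇒0≤− a≤x))

    step-lower : ∀ {δ a b} → 0# ≤ δ → x ≤ b → (P : Partition δ a b) → x − a ≤ riemannSum χ P + δ
    step-lower {δ} {a} 0≤δ x≤a done = subst (x − a ≤_) (+-comm δ 0#)
      (0≤−⇒≤ (subst (0# ≤_) (solve 3 (λ x a δ → (a :- x) :+ δ := (δ :+ con (pos 0)) :- (x :- a)) refl x a δ) (+-nonneg (≤⇒0≤− x≤a) 0≤δ)))
    step-lower {δ} {a} 0≤δ x≤b (cell {c = c} t a≤t t≤c c−a≤δ rest) with c ≤? x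
    ... | yes c≤x with value t ≤? x
    ...   | yes _   = subst₂ _≤_
      (solve 3 (λ x a c → (c :- a) :+ (x :- c) := x :- a) refl x a c)
      (solve 4 (λ a c r δ → (c :- a) :+ (r :+ δ) := con (pos 1) :* (c :- a) :+ r :+ δ) refl a c (riemannSum χ rest) δ)
      (+-mono-≤ (≤-refl {c − a}) (step-lower 0≤δ x≤b rest))
    ...   | no  t≰x = contradiction (≤-trans t≤c c≤x) t≰x
    -- This cell ends beyond `x`, so `x − a` is at most one mesh width and it suffices that the
    -- Riemann sum is nonnegative.
    step-lower {δ} {a} 0≤δ x≤b P@(cell {c = c} t a≤t t≤c c−a≤δ rest) | no c≰x =
      ≤-trans (+-monoˡ-≤ (- a) (≰⇒≥ c≰x)) $ ≤-trans c−a≤δ $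
      subst (_≤ riemannSum χ P + δ) (+-identityˡ δ)
        (+-monoˡ-≤ δ (riemannSum-nonneg (λ t → 0≤indicator ⌊ value t ≤? x ⌋) P))

  riemannSum-affine : ∀ {f g : UnitReal → ℝ} {q c δ a b} → (∀ t → g t ≡ q + c * f t) →
    (P : Partition δ a b) → riemannSum g P ≡ q * (b − a) + c * riemannSum f P
  riemannSum-affine {q = q} {c} {a = a} g≡ done =
    solve 3 (λ q c a → con (pos 0) := q :* (a :- a) :+ c :* con (pos 0)) refl q c a
  riemannSum-affine {f} {g} {q} {c} {a = a} {b} g≡ (cell {c = d} t _ _ _ rest) = trans
    (cong₂ (λ x y → x * (d − a) + y) (g≡ t) (riemannSum-affine g≡ rest))
    (solve 7 (λ q c a b d x r → (q :+ c :* x) :* (d :- a) :+ (q :* (b :- d) :+ c :* r) :=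
                                q :* (b :- a) :+ c :* (x :* (d :- a) :+ r)) refl
      q c a b d (f t) (riemannSum f rest))

  mesh : ∀ {c ε} → 0# ≤ c → 0# < ε → ∃[ δ ] 0# < δ × c * δ ≤ ε
  mesh {c} {ε} 0≤c 0<ε@(0≤ε , _) = δ , *-pos 0<ε (⁻¹-pos 0<1+c) , ≤-trans c*δ≤[1+c]*δ (≤-reflexive (*-/-cancel (proj₂ 0<1+c)))
    where
    0<1+c : 0# < 1# + c
    0<1+c = +-pos-nonneg (0≤1 , 0≢1) 0≤c
    -- Dividing by `1# + c` rather than by `c` covers the case where `c` is zero.
    δ = ε / (1# + c)
    c*δ≤[1+c]*δ : c * δ ≤ (1# + c) * δ
    c*δ≤[1+c]*δ = *-monoʳ-≤ (*-nonneg 0≤ε (⁻¹-nonneg 0<1+c))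
      (subst (_≤ 1# + c) (+-identityˡ c) (+-monoˡ-≤ c 0≤1))

  -‿mono-≤ : ∀ {x y} → x ≤ y → - y ≤ - x
  -‿mono-≤ {x} {y} x≤y = 0≤−⇒≤ (subst (0# ≤_) (solve 2 (λ x y → y :- x := (:- x) :- (:- y)) refl x y) (≤⇒0≤− x≤y))

  absolute : ∀ d → ∃[ c ] 0# ≤ c × d ≤ c × - d ≤ c
  absolute d with ≤-total 0# d
  ... | inj₁ 0≤d = d , 0≤d , ≤-refl , ≤-trans (subst (- d ≤_) -0#≈0# (-‿mono-≤ 0≤d)) 0≤d
  ... | inj₂ d≤0 = let 0≤-d = subst (_≤ - d) -0#≈0# (-‿mono-≤ d≤0) in
    - d , 0≤-d , ≤-trans d≤0 0≤-d , ≤-refl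

  *-bound : ∀ {c d y δ} → 0# ≤ δ → d ≤ c → - d ≤ c → y ≤ δ → - y ≤ δ → d * y ≤ c * δ
  *-bound {c} {d} {y} {δ} 0≤δ d≤c -d≤c y≤δ -y≤δ with ≤-total 0# d
  ... | inj₁ 0≤d = ≤-trans (*-monoˡ-≤ 0≤d y≤δ) (*-monoʳ-≤ 0≤δ d≤c)
  ... | inj₂ d≤0 = subst (_≤ c * δ) (solve 2 (λ d y → (:- d) :* (:- y) := d :* y) refl d y)
    (≤-trans (*-monoˡ-≤ (subst (_≤ - d) -0#≈0# (-‿mono-≤ d≤0)) -y≤δ) (*-monoʳ-≤ 0≤δ -d≤c))

  perturb : ∀ {v c d y δ ε} → 0# ≤ δ → c * δ ≤ ε → d ≤ c → - d ≤ c → y ≤ δ → - y ≤ δ →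
    v + d * y ≤ v + ε × v ≤ v + d * y + ε
  perturb {v} {c} {d} {y} {δ} {ε} 0≤δ cδ≤ε d≤c -d≤c y≤δ -y≤δ =
    +-mono-≤ ≤-refl (≤-trans (*-bound 0≤δ d≤c -d≤c y≤δ -y≤δ) cδ≤ε) ,
    0≤−⇒≤ (subst (0# ≤_) (solve 4 (λ v d y ε → ε :- (:- d) :* y := (v :+ d :* y :+ ε) :- v) refl v d y ε)
      (≤⇒0≤− (≤-trans (*-bound 0≤δ -d≤c (subst (_≤ c) (sym (-‿involutive d)) d≤c) y≤δ -y≤δ) cδ≤ε)))

  -- The integrand is q + (p - q) χ, so each Riemann sum differs from the claimed integral by (p -
  -- q)(R - x). Here R is the Riemann sum of χ, within one mesh width of x; the mesh is chosen from
  -- ε and the absolute value of p - q.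
  integral-step : ∀ {x} → 0# ≤ x → x ≤ 1# → (p q : ℝ) →
    IsIntegral (λ t → if ⌊ value t ≤? x ⌋ then p else q) (x * p + (1# − x) * q)
  integral-step {x} 0≤x x≤1 p q ε 0<ε =
    let c , 0≤c , d≤c , -d≤c = absolute (p − q)
        δ , 0<δ , cδ≤ε = mesh 0≤c 0<ε
    in δ , 0<δ , λ P → subst (λ r → r ≤ v + ε × v ≤ r + ε) (sym (sum≡ P))
      (perturb (proj₁ 0<δ) cδ≤ε d≤c -d≤c (deviation≤ (step-upper (proj₁ 0<δ) 0≤x P)) (-deviation≤ (step-lower (proj₁ 0<δ) x≤1 P)))
    where
    open StepFunction x

    R : ∀ {δ} → Partition δ 0# 1# → ℝ
    R P = riemannSum χ P

    v = x * p + (1# − x) * q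

    sum≡ : ∀ {δ} (P : Partition δ 0# 1#) →
      riemannSum (λ t → if ⌊ value t ≤? x ⌋ then p else q) P ≡ v + (p − q) * (R P − x)
    sum≡ P = trans (riemannSum-affine (λ t → affine ⌊ value t ≤? x ⌋) P)
      (solve 4 (λ x p q r → q :* (con (pos 1) :- con (pos 0)) :+ (p :- q) :* r :=
         x :* p :+ (con (pos 1) :- x) :* q :+ (p :- q) :* (r :- x)) refl x p q (R P))
      where
      affine : ∀ b → (if b then p else q) ≡ q + (p − q) * indicator b
      affine true  = solve 2 (λ p q → p := q :+ (p :- q) :* con (pos 1)) refl p q
      affine false = solve 2 (λ p q → q := q :+ (p :- q) :* con (pos 0)) refl p q

    deviation≤ : ∀ {δ r} → r ≤ x − 0# + δ → r − x ≤ δ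
    deviation≤ {δ} {r} r≤ = 0≤−⇒≤ (subst (0# ≤_)
      (solve 3 (λ x δ r → (x :- con (pos 0) :+ δ) :- r := δ :- (r :- x)) refl x δ r) (≤⇒0≤− r≤))

    -deviation≤ : ∀ {δ r} → x − 0# ≤ r + δ → - (r − x) ≤ δ
    -deviation≤ {δ} {r} ≤r = 0≤−⇒≤ (subst (0# ≤_)
      (solve 3 (λ x δ r → (r :+ δ) :- (x :- con (pos 0)) := δ :- (:- (r :- x))) refl x δ r) (≤⇒0≤− ≤r))

  riemannSum-cong : ∀ {f g δ a b} → (∀ t → f t ≡ g t) → (P : Partition δ a b) → riemannSum f P ≡ riemannSum g P
  riemannSum-cong f≗g done                            = refl
  riemannSum-cong f≗g (cell {a} {c} t _ _ _ rest) =
    cong₂ (λ y r → y * (c − a) + r) (f≗g t) (riemannSum-cong f≗g rest)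

  IsIntegral-cong : ∀ {f g v} → (∀ t → f t ≡ g t) → IsIntegral f v → IsIntegral g v
  IsIntegral-cong {v = v} f≗g f-int ε 0<ε with δ , 0<δ , bounds ← f-int ε 0<ε =
    δ , 0<δ , λ P → subst (λ r → r ≤ v + ε × v ≤ r + ε) (riemannSum-cong f≗g P) (bounds P)

  IsExpectation-cong : ∀ {f g v} → (∀ ω → f ω ≡ g ω) → IsExpectation f v → IsExpectation g v
  IsExpectation-cong f≗g (const f≡v)            = const λ ω → trans (sym (f≗g ω)) (f≡v ω)
  IsExpectation-cong f≗g (integrate h f-exp h-int) =
    integrate h (λ x → IsExpectation-cong (λ ω → f≗g (cons x ω)) (f-exp x)) h-int

  -- Multi-affine functions under independent rounding.

  module _ {m : ℕ} where

    -- `affine` says that each coordinate can be interpolated between its values at 0 and 1, so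
    -- independent 0-1 coordinates may be replaced by their means. `cong-F` stands in for function
    -- extensionality, since updated vectors agree only pointwise.
    record MultiAffine (F : (Fin m → ℝ) → ℝ) : Set where
      field
        cong-F : ∀ {y z} → (∀ v → y v ≡ z v) → F y ≡ F z
        affine : ∀ u y p → F (y [ u ≔ p ]) ≡ p * F (y [ u ≔ 1# ]) + (1# − p) * F (y [ u ≔ 0# ])

    ≔-absorb : (y : Fin m → ℝ) → ∀ u p q v → (y [ u ≔ p ] [ u ≔ q ]) v ≡ (y [ u ≔ q ]) v
    ≔-absorb y u p q v with v ≟ u
    ... | yes _ = refl
    ... | no  _ = refl

    ≔-comm : (y : Fin m → ℝ) → ∀ {u w} p q → u ≢ w → ∀ v → (y [ u ≔ p ] [ w ≔ q ]) v ≡ (y [ w ≔ q ] [ u ≔ p ]) v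
    ≔-comm y {u} {w} p q u≢w v with v ≟ w | v ≟ u
    ... | yes refl | yes refl = contradiction refl u≢w
    ... | yes _    | no  _    = refl
    ... | no  _    | yes _    = refl
    ... | no  _    | no  _    = refl

    MultiAffine-≔ : ∀ {F} u p → MultiAffine F → MultiAffine (λ y → F (y [ u ≔ p ]))
    MultiAffine-≔ {F} u p F-affine = record
      { cong-F = λ y≗z → cong-F λ v → cong (if ⌊ v ≟ u ⌋ then p else_) (y≗z v)
      ; affine = affine′ }
      where
      open MultiAffine F-affine
      affine′ : ∀ w y q → F (y [ w ≔ q ] [ u ≔ p ]) ≡ q * F (y [ w ≔ 1# ] [ u ≔ p ]) + (1# − q) * F (y [ w ≔ 0# ] [ u ≔ p ])
      affine′ w y q with w ≟ u
      ... | yes refl = trans (absorb q) (trans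
        (solve 2 (λ q x → x := q :* x :+ (con (pos 1) :- q) :* x) refl q _)
        (sym (cong₂ (λ s t → q * s + (1# − q) * t) (absorb 1#) (absorb 0#))))
        where
        absorb : ∀ r → F (y [ w ≔ r ] [ w ≔ p ]) ≡ F (y [ w ≔ p ])
        absorb r = cong-F (≔-absorb y w r p)
      ... | no w≢u = trans (swap q) (trans (affine w (y [ u ≔ p ]) q)
        (sym (cong₂ (λ s t → q * s + (1# − q) * t) (swap 1#) (swap 0#))))
        where
        swap : ∀ r → F (y [ w ≔ r ] [ u ≔ p ]) ≡ F (y [ u ≔ p ] [ w ≔ r ])
        swap r = cong-F (≔-comm y r p w≢u)

    selected : (Fin m → ℝ) → List (Fin m) → Tape → Fin m → Bool
    selected x []       ω v = false
    selected x (u ∷ us) ω v = if ⌊ v ≟ u ⌋ then ⌊ value (ω 0) ≤? x u ⌋ else selected x us (ω ∘ suc) v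

    mean : (Fin m → ℝ) → List (Fin m) → Fin m → ℝ
    mean x []       v = 0#
    mean x (u ∷ us) v = (mean x us [ u ≔ x u ]) v

    -- Induction on the arrivals. Fixing the first draw fixes coordinate `u` to 0 or 1 and leaves a
    -- multi-affine function, whose expectation is known by induction. As a function of the first
    -- draw that expectation is a step function with threshold `x u`, and its integral is the affine
    -- interpolation at `x u`.
    expectation-selected : ∀ {x F} → (∀ v → 0# ≤ x v × x v ≤ 1#) → MultiAffine F → ∀ us →
      IsExpectation (λ ω → F (indicator ∘ selected x us ω)) (F (mean x us))
    expectation-selected x∈[0,1] F-affine []       = const λ ω → refl
    expectation-selected {x} {F} x∈[0,1] F-affine (u ∷ us) = integrate
      (λ t → F (mean x us [ u ≔ indicator ⌊ value t ≤? x u ⌋ ]))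
      (λ t → IsExpectation-cong (λ ω → cong-F (λ v → split t ω v ⌊ v ≟ u ⌋))
               (expectation-selected x∈[0,1] (MultiAffine-≔ u (indicator ⌊ value t ≤? x u ⌋) F-affine) us))
      (subst (IsIntegral _) (sym (affine u (mean x us) (x u)))
        (IsIntegral-cong (λ t → choose ⌊ value t ≤? x u ⌋)
          (integral-step (proj₁ (x∈[0,1] u)) (proj₂ (x∈[0,1] u)) (F (mean x us [ u ≔ 1# ])) (F (mean x us [ u ≔ 0# ])))))
      where
      open MultiAffine F-affine
      choose : ∀ b → (if b then F (mean x us [ u ≔ 1# ]) else F (mean x us [ u ≔ 0# ])) ≡ F (mean x us [ u ≔ indicator b ])
      choose true  = refl
      choose false = refl

      split : ∀ t ω v b → (if b then indicator ⌊ value t ≤? x u ⌋ else indicator (selected x us ω v)) ≡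
        indicator (if b then ⌊ value t ≤? x u ⌋ else selected x us ω v)
      split t ω v true  = refl
      split t ω v false = refl

-- Execution of programs

⌊⌋-true : ∀ {P : Set} (P? : Dec P) → P → ⌊ P? ⌋ ≡ true
⌊⌋-true (yes _) p = refl
⌊⌋-true (no ¬p) p = contradiction p ¬p

⌊⌋-false : ∀ {P : Set} (P? : Dec P) → ¬ P → ⌊ P? ⌋ ≡ false
⌊⌋-false (yes p) ¬p = contradiction p ¬p
⌊⌋-false (no _)  ¬p = refl

≡ᵇ-toℕ : ∀ {m} (u v : Fin m) → (toℕ u ≡ᵇ toℕ v) ≡ ⌊ v ≟ u ⌋
≡ᵇ-toℕ zero    zero    = refl
≡ᵇ-toℕ zero    (suc v) = refl
≡ᵇ-toℕ (suc u) zero    = refl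
≡ᵇ-toℕ (suc u) (suc v) with v ≟ u | ≡ᵇ-toℕ u v
... | yes _ | eq = eq
... | no  _ | eq = eq

lookup-⁅⁆ : ∀ {m} (u v : Fin m) → lookup ⁅ u ⁆ v ≡ ⌊ v ≟ u ⌋
lookup-⁅⁆ zero    zero    = refl
lookup-⁅⁆ zero    (suc v) = lookup-replicate v false
lookup-⁅⁆ (suc u) zero    = refl
lookup-⁅⁆ (suc u) (suc v) with v ≟ u | lookup-⁅⁆ u v
... | yes _ | eq = eq
... | no  _ | eq = eq

lookup-∪⁅⁆ : ∀ {m} (S : Subset m) u v → lookup (S ∪ ⁅ u ⁆) v ≡ lookup S v ∨ ⌊ v ≟ u ⌋
lookup-∪⁅⁆ S u v = trans (lookup-zipWith _∨_ v S ⁅ u ⁆) (cong (lookup S v ∨_) (lookup-⁅⁆ u v))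

lookup-∪⁅⁆-self : ∀ {m} (R : Subset m) u → lookup (R ∪ ⁅ u ⁆) u ≡ true
lookup-∪⁅⁆-self R u = trans (lookup-∪⁅⁆ R u u) (trans (cong (lookup R u ∨_) (⌊⌋-true (u ≟ u) refl)) (∨-zeroʳ _))

lookup-∪⁅⁆-other : ∀ {m} (R : Subset m) {u v} → v ≢ u → lookup (R ∪ ⁅ u ⁆) v ≡ lookup R v
lookup-∪⁅⁆-other R {u} {v} v≢u = trans (lookup-∪⁅⁆ R u v) (trans (cong (lookup R v ∨_) (⌊⌋-false (v ≟ u) v≢u)) (∨-identityʳ _))

-- Needed for removing `zero`: on the tail, `S - zero` unfolds to a difference with `∅`.
lookup-∅ : ∀ {m} (S : Subset m) v → lookup (S ─ ∅) v ≡ lookup S v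
lookup-∅ (b ∷ S) zero    = refl
lookup-∅ (b ∷ S) (suc v) = lookup-∅ S v

lookup-- : ∀ {m} (S : Subset m) u v → lookup (S - u) v ≡ (if ⌊ v ≟ u ⌋ then false else lookup S v)
lookup-- (b ∷ S) zero    zero    = refl
lookup-- (b ∷ S) zero    (suc v) = lookup-∅ S v
lookup-- (b ∷ S) (suc u) zero    = refl
lookup-- (b ∷ S) (suc u) (suc v) with v ≟ u | lookup-- S u v
... | yes _ | eq = eq
... | no  _ | eq = eq

counter : NatExp
counter = natCell 0 (lit 0)

-- Tests compare by ≤ only, so the strict comparison of the counter with the number of nodes is
-- written with a successor.
forEachNode : Program → Program
forEachNode p = setNat 0 (lit 0) (lit 0) ⨾
  while ((counter ⊕ lit 1) ≤ᴺ ∣V∣) (p ⨾ setNat 0 (lit 0) (counter ⊕ lit 1))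

module Execution (ℛ : RealNumbers) where
  open RealNumbers ℛ using (ℝ)
  open Dicut ℛ
  open Store

  node-toℕ : ∀ {m} (v : Fin m) → node (toℕ v) ≡ just v
  node-toℕ {m} v with toℕ v ℕ.<? m
  ... | yes v<m = cong just (fromℕ<-toℕ v v<m)
  ... | no  v≮m = contradiction (toℕ<n v) v≮m

  update-toℕ : ∀ {m} {A : Set} (μ : ℕ → ℕ → A) a {i} (u : Fin m) x v → i ≡ toℕ u →
    update μ a i x a (toℕ v) ≡ (if ⌊ v ≟ u ⌋ then x else μ a (toℕ v))
  update-toℕ μ a u x v refl rewrite Equivalence.to T-≡ (ℕ.≡⇒≡ᵇ a a refl) | ≡ᵇ-toℕ u v = refl

  module Machine {m} (G : Digraph m) (ω : Tape) (R : Subset m) (new : Fin m) where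

    infix 4 _⊢_⟶_within_
    -- Stated in continuation-passing form: any halting run of the remaining stack from `s′` extends
    -- backwards to one that first executes the program from `s`. Composition then amounts to
    -- applying one such map after another, with the time bounds adding up.
    _⊢_⟶_within_ : Program → Store m → Store m → ℕ → Set
    p ⊢ s ⟶ s′ within B = ∀ {k t s″} → Halts G ω R new (k , s′) t s″ →
      ∃[ t′ ] Halts G ω R new (p ∷ k , s) t′ s″ × t′ ℕ.≤ B ℕ.+ t

    exec-step : ∀ {p s s′} → (∀ k → step G ω R new p k s ≡ (k , s′)) → p ⊢ s ⟶ s′ within 1
    exec-step {p} {s} step≡ {k} {t} {s″} h =
      suc t , next (subst (λ c → Halts G ω R new c t s″) (sym (step≡ k)) h) , ℕ.≤-refl

    exec-⨾ : ∀ {p q s s′ s″ B C} → p ⊢ s ⟶ s′ within B → q ⊢ s′ ⟶ s″ within C →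
      (p ⨾ q) ⊢ s ⟶ s″ within (suc (B ℕ.+ C))
    exec-⨾ {B = B} {C} p⟶ q⟶ {t = t} h with t₁ , h₁ , t₁≤ ← q⟶ h with t₂ , h₂ , t₂≤ ← p⟶ h₁ =
      suc t₂ , next h₂ , s≤s (ℕ.≤-trans t₂≤ (ℕ.≤-trans (ℕ.+-monoʳ-≤ B t₁≤) (ℕ.≤-reflexive (sym (ℕ.+-assoc B C t)))))

    exec-weaken : ∀ {p s s′ B C} → B ℕ.≤ C → p ⊢ s ⟶ s′ within B → p ⊢ s ⟶ s′ within C
    exec-weaken B≤C p⟶ {t = t} h with t′ , h′ , t′≤ ← p⟶ h = t′ , h′ , ℕ.≤-trans t′≤ (ℕ.+-monoˡ-≤ t B≤C)

    exec-if-true : ∀ {b p q s s′ B} → evalTest G ω R new s b ≡ true → p ⊢ s ⟶ s′ within B →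
      ifElse b p q ⊢ s ⟶ s′ within (suc B)
    exec-if-true {b} {p} {q} {s} b≡true p⟶ {k} {t} {s″} h with t′ , h′ , t′≤ ← p⟶ h =
      suc t′ , next (subst (λ c → Halts G ω R new ((if c then p ∷ k else q ∷ k) , s) t′ s″) (sym b≡true) h′) , s≤s t′≤

    exec-if-false : ∀ {b p q s s′ B} → evalTest G ω R new s b ≡ false → q ⊢ s ⟶ s′ within B →
      ifElse b p q ⊢ s ⟶ s′ within (suc B)
    exec-if-false {b} {p} {q} {s} b≡false q⟶ {k} {t} {s″} h with t′ , h′ , t′≤ ← q⟶ h =
      suc t′ , next (subst (λ c → Halts G ω R new ((if c then p ∷ k else q ∷ k) , s) t′ s″) (sym b≡false) h′) , s≤s t′≤

    exec-while-true : ∀ {b p s s′ s″ B C} → evalTest G ω R new s b ≡ true →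
      p ⊢ s ⟶ s′ within B → while b p ⊢ s′ ⟶ s″ within C → while b p ⊢ s ⟶ s″ within (suc (B ℕ.+ C))
    -- A successful test leads to the same configuration as the first step of `p ⨾ while b p`, so
    -- only that first step is exchanged.
    exec-while-true {b} {p} {s} b≡true p⟶ w⟶ {k} {t} {s‴} h with exec-⨾ p⟶ w⟶ h
    ... | suc t′ , next h′ , t′≤ =
      suc t′ , next (subst (λ c → Halts G ω R new ((if c then p ∷ while b p ∷ k else k) , s) t′ s‴) (sym b≡true) h′) , t′≤

    exec-while-false : ∀ {b p s} → evalTest G ω R new s b ≡ false → while b p ⊢ s ⟶ s within 1
    exec-while-false {b} {p} {s} b≡false {k} {t} {s″} h =
      suc t , next (subst (λ c → Halts G ω R new ((if c then p ∷ while b p ∷ k else k) , s) t s″) (sym b≡false) h) , ℕ.≤-refl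

    -- Loop rule with an invariant indexed by the counter. `frame` makes the invariant insensitive
    -- to the natural-number memory, because the loop itself writes the counter there. Each round
    -- costs 3 steps besides the body: the test, the sequencing and the increment. The final 3 are
    -- the outer sequencing, the initialisation and the failing test.
    exec-forEachNode : ∀ {p B} (I : ℕ → Store m → Set) →
      (∀ {c s} ν → I c s → I c (record s { nats = ν })) →
      (∀ v {s} → nats s 0 0 ≡ toℕ v → I (toℕ v) s →
        ∃[ s′ ] p ⊢ s ⟶ s′ within B × nats s′ 0 0 ≡ toℕ v × I (suc (toℕ v)) s′) →
      ∀ {s} → I 0 s →
      ∃[ s′ ] forEachNode p ⊢ s ⟶ s′ within (m ℕ.* (3 ℕ.+ B) ℕ.+ 3) × I m s′
    exec-forEachNode {p} {B} I frame body {s} I0 =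
      let s′ , w⟶ , Im = loop m 0 (ℕ.+-identityʳ m) {record s { nats = update (nats s) 0 0 0 }} refl (frame _ I0) in
      s′ , exec-weaken (ℕ.≤-reflexive (trans (cong (2 ℕ.+_) (ℕ.+-comm _ 1)) (ℕ.+-comm 3 _)))
             (exec-⨾ (exec-step (λ _ → refl)) w⟶) , Im
      where
      b : Test
      b = (counter ⊕ lit 1) ≤ᴺ ∣V∣

      loop : ∀ n c → n ℕ.+ c ≡ m → ∀ {s} → nats s 0 0 ≡ c → I c s →
        ∃[ s′ ] while b (p ⨾ setNat 0 (lit 0) (counter ⊕ lit 1)) ⊢ s ⟶ s′ within (n ℕ.* (3 ℕ.+ B) ℕ.+ 1) × I m s′
      loop zero    c refl {s} c≡ Ic = s , exec-while-false (⌊⌋-false (_ ℕ.≤? _)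
        (λ c+1≤c → ℕ.1+n≰n (subst (ℕ._≤ c) (trans (cong (ℕ._+ 1) c≡) (ℕ.+-comm c 1)) c+1≤c))) , Ic
      loop (suc n) c n+c≡m {s} c≡ Ic = iterate (body (fromℕ< c<m) (trans c≡ (sym (toℕ-fromℕ< c<m))) (subst (λ c → I c s) (sym (toℕ-fromℕ< c<m)) Ic))
        where
        c<m : c ℕ.< m
        c<m = subst (suc c ℕ.≤_) (trans (ℕ.+-suc n c) n+c≡m) (ℕ.m≤n+m (suc c) n)

        iterate : ∃[ s₁ ] p ⊢ s ⟶ s₁ within B × nats s₁ 0 0 ≡ toℕ (fromℕ< c<m) × I (suc (toℕ (fromℕ< c<m))) s₁ →
          ∃[ s′ ] while b (p ⨾ setNat 0 (lit 0) (counter ⊕ lit 1)) ⊢ s ⟶ s′ within (suc n ℕ.* (3 ℕ.+ B) ℕ.+ 1) × I m s′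
        iterate (s₁ , p⟶ , c₁≡ , Ic₁)
          with s′ , w⟶ , Im ← loop n (suc c) (trans (ℕ.+-suc n c) n+c≡m)
            {record s₁ { nats = update (nats s₁) 0 0 (nats s₁ 0 0 ℕ.+ 1) }}
            (trans (ℕ.+-comm _ 1) (cong suc (trans c₁≡ (toℕ-fromℕ< c<m))))
            (frame _ (subst (λ c → I (suc c) s₁) (toℕ-fromℕ< c<m) Ic₁)) =
          s′ , exec-weaken (ℕ.≤-reflexive bound)
            (exec-while-true (⌊⌋-true (_ ℕ.≤? _) (subst (ℕ._≤ m) (sym (trans (cong (ℕ._+ 1) c≡) (ℕ.+-comm c 1))) c<m))
              (exec-⨾ p⟶ (exec-step (λ _ → refl))) w⟶) , Im
          where
          bound : suc (suc (B ℕ.+ 1) ℕ.+ (n ℕ.* (3 ℕ.+ B) ℕ.+ 1)) ≡ suc n ℕ.* (3 ℕ.+ B) ℕ.+ 1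
          bound = trans (cong (λ x → 2 ℕ.+ (x ℕ.+ (n ℕ.* (3 ℕ.+ B) ℕ.+ 1))) (ℕ.+-comm B 1))
            (sym (ℕ.+-assoc (3 ℕ.+ B) (n ℕ.* (3 ℕ.+ B)) 1))

-- The algorithm

<ᵇ-suc : ∀ {m} (u v : Fin m) → (toℕ v <ᵇ suc (toℕ u)) ≡ (toℕ v <ᵇ toℕ u) ∨ ⌊ v ≟ u ⌋
<ᵇ-suc zero    zero    = refl
<ᵇ-suc zero    (suc v) = refl
<ᵇ-suc (suc u) zero    = refl
<ᵇ-suc (suc u) (suc v) with v ≟ u | <ᵇ-suc u v
... | yes _ | eq = eq
... | no  _ | eq = eq

<ᵇ-irrefl : ∀ n → (n <ᵇ n) ≡ false
<ᵇ-irrefl zero    = refl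
<ᵇ-irrefl (suc n) = <ᵇ-irrefl n

toℕ-<ᵇ : ∀ {m} (v : Fin m) → (toℕ v <ᵇ m) ≡ true
toℕ-<ᵇ v = Equivalence.to T-≡ (ℕ.<⇒<ᵇ (toℕ<n v))

-- `charge` skips loops: they cross no cut, but would distort the bias and make the expected cut
-- quadratic in a coordinate. Equality of the two indices is tested by two inequalities.
chargeArc charge : Program
chargeArc = setReal 1 arriving (realCell 1 arriving ⊕ weight arriving counter) ⨾
            setReal 2 counter (realCell 2 counter ⊕ weight arriving counter)
charge = ifElse (arriving ≤ᴺ counter) (ifElse (counter ≤ᴺ arriving) skip chargeArc) chargeArc

-- This may be run for every node of the graph, revealed or not, since discarding a node outside the
-- solution changes nothing.
retain : ℕ → Program
retain k = ifElse (realCell 0 counter ≤ᴿ (lit (selection k) ⊘ lit 200)) skip (discard counter)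

-- The bias is at most (50 + k)/200 iff (200 - (50 + k)) out ≤ (50 + k) in.
prune : ℕ → ℕ → Program
prune zero    k = retain k
prune (suc n) k = ifElse ((lit (200 ∸ (50 ℕ.+ k)) ⊗ realCell 1 counter) ≤ᴿ (lit (50 ℕ.+ k) ⊗ realCell 2 counter))
  (retain k) (prune n (suc k))

-- Arrays 0, 1 and 2 hold the draws, the weight leaving each node and the weight entering it.
algorithm : Program
algorithm = draw 0 arriving ⨾ forEachNode charge ⨾ forEachNode (prune 101 0)

-- Correctness of the program on one arrival.

module Algorithm (ℛ : RealNumbers) where
  open OrderedField ℛ
  open Dicut ℛ
  open Execution ℛ
  open Digraph
  open Store

  sum-zero : ∀ {n} {f : Fin n → ℝ} → (∀ v → f v ≡ 0#) → sum f ≡ 0#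
  sum-zero {zero}  f≡0 = refl
  sum-zero {suc n} f≡0 = trans (cong₂ _+_ (f≡0 zero) (sum-zero (f≡0 ∘ suc))) (+-identityˡ 0#)

  sum-single : ∀ {n} (g : Fin n → ℝ) u → sum (λ v → if ⌊ v ≟ u ⌋ then g v else 0#) ≡ g u
  sum-single {suc n} g zero    = trans (cong (g zero +_) (sum-zero {n} {λ _ → 0#} λ v → refl)) (+-identityʳ _)
  sum-single {suc n} g (suc u) = trans (+-identityˡ _) (trans (sum-cong-≗ (λ v → shift v)) (sum-single (g ∘ suc) u))
    where
    shift : ∀ v → (if ⌊ suc v ≟ suc u ⌋ then g (suc v) else 0#) ≡ (if ⌊ v ≟ u ⌋ then g (suc v) else 0#)
    shift v with v ≟ u
    ... | yes _ = refl
    ... | no  _ = refl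

  if-insert : ∀ {n} {mask mask′ : Fin n → Bool} (g : Fin n → ℝ) u → mask u ≡ false →
    (∀ v → mask′ v ≡ mask v ∨ ⌊ v ≟ u ⌋) → ∀ v →
    (if mask′ v then g v else 0#) ≡ (if mask v then g v else 0#) + (if ⌊ v ≟ u ⌋ then g v else 0#)
  if-insert {mask = mask} g u mask≡false mask′≡ v rewrite mask′≡ v with v ≟ u
  ... | yes refl rewrite mask≡false = sym (+-identityˡ _)
  ... | no  _    rewrite ∨-identityʳ (mask v) = sym (+-identityʳ _)

  sum-insert : ∀ {n} {mask mask′ : Fin n → Bool} (g : Fin n → ℝ) u → mask u ≡ false →
    (∀ v → mask′ v ≡ mask v ∨ ⌊ v ≟ u ⌋) →
    sum (λ v → if mask′ v then g v else 0#) ≡ sum (λ v → if mask v then g v else 0#) + g u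
  sum-insert {mask = mask} g u mask≡false mask′≡ = trans (sum-cong-≗ (if-insert g u mask≡false mask′≡)) $
    trans (∑-distrib-+ (λ v → if mask v then g v else 0#) (λ v → if ⌊ v ≟ u ⌋ then g v else 0#)) $
    cong (sum (λ v → if mask v then g v else 0#) +_) (sum-single g u)

  rate : ℕ → ℝ
  rate k = fromℕ (selection k) / fromℕ 200

  -- The search performed by `prune`, as a function. After `n` failed tests the result is `k + n`,
  -- which is the top class 101 for the starting values 101 and 0.
  classify : ℕ → ℕ → ℝ → ℝ → ℕ
  classify zero    k out inn = k
  classify (suc n) k out inn =
    if ⌊ fromℕ (200 ∸ (50 ℕ.+ k)) * out ≤? fromℕ (50 ℕ.+ k) * inn ⌋ then k else classify n (suc k) out inn

  record Snapshot (m : ℕ) : Set where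
    field
      count           : ℕ
      draws outs inns : Fin m → ℝ
      kept            : Fin m → Bool

  open Snapshot

  -- Agreement is required only on the cells that represent nodes. The natural-number memory stays
  -- unconstrained, which gives `∼-frame`.
  record _∼_ {m} (s : Store m) (σ : Snapshot m) : Set where
    field
      count≡ : drawn s ≡ count σ
      draws≡ : ∀ v → reals s 0 (toℕ v) ≡ draws σ v
      outs≡  : ∀ v → reals s 1 (toℕ v) ≡ outs σ v
      inns≡  : ∀ v → reals s 2 (toℕ v) ≡ inns σ v
      kept≡  : ∀ v → lookup (solution s) v ≡ kept σ v

  open _∼_

  ∼-frame : ∀ {m} {s : Store m} {σ} ν → s ∼ σ → record s { nats = ν } ∼ σ
  ∼-frame ν s∼σ = record
    { count≡ = count≡ s∼σ ; draws≡ = draws≡ s∼σ ; outs≡ = outs≡ s∼σ ; inns≡ = inns≡ s∼σ ; kept≡ = kept≡ s∼σ }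

  module _ {m} (G : Digraph m) where

    arcWeight : Fin m → Fin m → ℝ
    arcWeight u v = if ⌊ v ≟ u ⌋ then 0# else fromMaybe 0# (arcs G u v)

    module _ (ω : Tape) (R : Subset m) (new : Fin m) (new∈R : lookup R new ≡ true) where
      open Machine G ω R new

      query-new : ∀ {c} v → c ≡ toℕ v → query G ω R new (toℕ new) c ≡ arcs G new v
      query-new v refl rewrite node-toℕ new | node-toℕ v | new∈R = refl

      chargeArc-correct : ∀ {s σ} u → u ≢ new → nats s 0 0 ≡ toℕ u → s ∼ σ →
        ∃[ s′ ] chargeArc ⊢ s ⟶ s′ within 3 × nats s′ 0 0 ≡ toℕ u ×
          s′ ∼ record σ { outs = outs σ [ new ≔ outs σ new + arcWeight new u ]
                        ; inns = inns σ [ u ≔ inns σ u + arcWeight new u ] }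
      chargeArc-correct {s} {σ} u u≢new c≡u s∼σ =
        _ , exec-⨾ (exec-step (λ _ → refl)) (exec-step (λ _ → refl)) , c≡u , record
          { count≡ = count≡ s∼σ
          ; draws≡ = draws≡ s∼σ
          ; outs≡  = λ v → trans (update-toℕ (reals s) 1 new _ v refl)
              (cong₂ (λ x y → if ⌊ v ≟ new ⌋ then x else y) (cong₂ _+_ (outs≡ s∼σ new) weight≡) (outs≡ s∼σ v))
          ; inns≡  = λ v → trans (update-toℕ (update (reals s) 1 (toℕ new) (reals s 1 (toℕ new) + fromMaybe 0# (query G ω R new (toℕ new) (nats s 0 0)))) 2 u _ v c≡u)
              (cong₂ (λ x y → if ⌊ v ≟ u ⌋ then x else y) (cong₂ _+_ (trans (cong (reals s 2) c≡u) (inns≡ s∼σ u)) weight≡) (inns≡ s∼σ v))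
          ; kept≡  = kept≡ s∼σ
          }
        where
        weight≡ : fromMaybe 0# (query G ω R new (toℕ new) (nats s 0 0)) ≡ arcWeight new u
        weight≡ = trans (cong (fromMaybe 0#) (query-new u c≡u))
          (cong (if_then 0# else fromMaybe 0# (arcs G new u)) (sym (⌊⌋-false (u ≟ new) u≢new)))

      charge-correct : ∀ {s σ} u → nats s 0 0 ≡ toℕ u → s ∼ σ →
        ∃[ s′ ] charge ⊢ s ⟶ s′ within 5 × nats s′ 0 0 ≡ toℕ u ×
          s′ ∼ record σ { outs = outs σ [ new ≔ outs σ new + arcWeight new u ]
                        ; inns = inns σ [ u ≔ inns σ u + arcWeight new u ] }
      charge-correct {s} {σ} u c≡u s∼σ = by-cases (u ≟ new) (toℕ new ℕ.≤? nats s 0 0)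
        where
        Goal : Set
        Goal = ∃[ s′ ] charge ⊢ s ⟶ s′ within 5 × nats s′ 0 0 ≡ toℕ u ×
          s′ ∼ record σ { outs = outs σ [ new ≔ outs σ new + arcWeight new u ]
                        ; inns = inns σ [ u ≔ inns σ u + arcWeight new u ] }

        by-cases : Dec (u ≡ new) → Dec (toℕ new ℕ.≤ nats s 0 0) → Goal
        -- The program skips the loop at `new`; this matches the stated update because `arcWeight`
        -- is zero on loops.
        by-cases (yes refl) _ = s , exec-weaken (ℕ.m≤m+n 3 2)
          (exec-if-true (⌊⌋-true (_ ℕ.≤? _) (ℕ.≤-reflexive (sym c≡u)))
            (exec-if-true (⌊⌋-true (_ ℕ.≤? _) (ℕ.≤-reflexive c≡u)) (exec-step (λ _ → refl)))) , c≡u , record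
          { count≡ = count≡ s∼σ ; draws≡ = draws≡ s∼σ ; kept≡ = kept≡ s∼σ
          ; outs≡ = λ v → trans (outs≡ s∼σ v) (unchanged (outs σ) v)
          ; inns≡ = λ v → trans (inns≡ s∼σ v) (unchanged (inns σ) v) }
          where
          unchanged : (y : Fin m → ℝ) → ∀ v → y v ≡ (y [ u ≔ y u + arcWeight u u ]) v
          unchanged y v with v ≟ u
          ... | no  _    = refl
          ... | yes refl = trans (sym (+-identityʳ _))
            (cong (λ b → y u + (if b then 0# else fromMaybe 0# (arcs G u u))) (sym (⌊⌋-true (u ≟ u) refl)))
        by-cases (no u≢new) (yes new≤c) with s′ , exec , c≡ , s′∼ ← chargeArc-correct u u≢new c≡u s∼σ =
          s′ , exec-if-true (⌊⌋-true (_ ℕ.≤? _) new≤c) (exec-if-false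
            (⌊⌋-false (_ ℕ.≤? _) λ c≤new → u≢new (toℕ-injective (ℕ.≤-antisym (subst (ℕ._≤ toℕ new) c≡u c≤new) (subst (toℕ new ℕ.≤_) c≡u new≤c)))) exec) , c≡ , s′∼
        by-cases (no u≢new) (no new≰c) with s′ , exec , c≡ , s′∼ ← chargeArc-correct u u≢new c≡u s∼σ =
          s′ , exec-weaken (ℕ.m≤m+n 4 1) (exec-if-false (⌊⌋-false (_ ℕ.≤? _) new≰c) exec) , c≡ , s′∼

      retained : Snapshot m → ℕ → Fin m → Bool
      retained σ k u = ⌊ draws σ u ≤? rate k ⌋

      retain-correct : ∀ {s σ} k u → nats s 0 0 ≡ toℕ u → s ∼ σ →
        ∃[ s′ ] retain k ⊢ s ⟶ s′ within 2 × nats s′ 0 0 ≡ toℕ u ×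
          s′ ∼ record σ { kept = kept σ [ u ≔ kept σ u ∧ retained σ k u ] }
      retain-correct {s} {σ} k u c≡u s∼σ = by-cases (retained σ k u) refl
        where
        test≡ : ⌊ reals s 0 (nats s 0 0) ≤? rate k ⌋ ≡ retained σ k u
        test≡ = cong (λ x → ⌊ x ≤? rate k ⌋) (trans (cong (reals s 0) c≡u) (draws≡ s∼σ u))

        by-cases : ∀ b → retained σ k u ≡ b → ∃[ s′ ] retain k ⊢ s ⟶ s′ within 2 × nats s′ 0 0 ≡ toℕ u ×
          s′ ∼ record σ { kept = kept σ [ u ≔ kept σ u ∧ retained σ k u ] }
        by-cases true b≡ = s , exec-if-true (trans test≡ b≡) (exec-step (λ _ → refl)) , c≡u , record
          { count≡ = count≡ s∼σ ; draws≡ = draws≡ s∼σ ; outs≡ = outs≡ s∼σ ; inns≡ = inns≡ s∼σ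
          ; kept≡ = λ v → trans (kept≡ s∼σ v) (unchanged v) }
          where
          unchanged : ∀ v → kept σ v ≡ (kept σ [ u ≔ kept σ u ∧ retained σ k u ]) v
          unchanged v with v ≟ u
          ... | no  _    = refl
          ... | yes refl rewrite b≡ = sym (∧-identityʳ _)
        by-cases false b≡ = _ , exec-if-false (trans test≡ b≡) (exec-step (λ _ → refl)) , c≡u , record
          { count≡ = count≡ s∼σ ; draws≡ = draws≡ s∼σ ; outs≡ = outs≡ s∼σ ; inns≡ = inns≡ s∼σ
          ; kept≡ = λ v → trans (cong (λ S → lookup S v) discard≡) (trans (lookup-- (solution s) u v)
              (cong₂ (λ x y → if ⌊ v ≟ u ⌋ then x else y) (sym (trans (cong (kept σ u ∧_) b≡) (∧-zeroʳ _))) (kept≡ s∼σ v))) }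
          where
          discard≡ : maybe′ (λ v → solution s - v) (solution s) (node (nats s 0 0)) ≡ solution s - u
          discard≡ rewrite c≡u | node-toℕ u = refl

      prune-correct : ∀ {s σ} n k u → nats s 0 0 ≡ toℕ u → s ∼ σ →
        ∃[ s′ ] prune n k ⊢ s ⟶ s′ within (n ℕ.+ 2) × nats s′ 0 0 ≡ toℕ u ×
          s′ ∼ record σ { kept = kept σ [ u ≔ kept σ u ∧ retained σ (classify n k (outs σ u) (inns σ u)) u ] }
      prune-correct zero    k u c≡u s∼σ = retain-correct k u c≡u s∼σ
      prune-correct {s} {σ} (suc n) k u c≡u s∼σ = by-cases test refl
        where
        test : Bool
        test = ⌊ fromℕ (200 ∸ (50 ℕ.+ k)) * outs σ u ≤? fromℕ (50 ℕ.+ k) * inns σ u ⌋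

        test≡ : evalTest G ω R new s ((lit (200 ∸ (50 ℕ.+ k)) ⊗ realCell 1 counter) ≤ᴿ (lit (50 ℕ.+ k) ⊗ realCell 2 counter)) ≡ test
        test≡ = cong₂ (λ x y → ⌊ fromℕ (200 ∸ (50 ℕ.+ k)) * x ≤? fromℕ (50 ℕ.+ k) * y ⌋)
          (trans (cong (reals s 1) c≡u) (outs≡ s∼σ u)) (trans (cong (reals s 2) c≡u) (inns≡ s∼σ u))

        by-cases : ∀ b → test ≡ b → ∃[ s′ ] (prune (suc n) k ⊢ s ⟶ s′ within (suc n ℕ.+ 2)) × nats s′ 0 0 ≡ toℕ u ×
          s′ ∼ record σ { kept = kept σ [ u ≔ kept σ u ∧ retained σ (if b then k else classify n (suc k) (outs σ u) (inns σ u)) u ] }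
        by-cases true test≡true with s′ , exec , c≡ , s′∼ ← retain-correct k u c≡u s∼σ =
          s′ , exec-weaken (s≤s (ℕ.m≤n+m 2 n)) (exec-if-true (trans test≡ test≡true) exec) , c≡ , s′∼
        by-cases false test≡false with s′ , exec , c≡ , s′∼ ← prune-correct n (suc k) u c≡u s∼σ =
          s′ , exec-if-false (trans test≡ test≡false) exec , c≡ , s′∼

      below : ℕ → Fin m → Bool
      below c v = toℕ v <ᵇ c

      -- The loop invariant after the first `c` nodes; `pruned` plays the same part for the second
      -- loop.
      charged : Snapshot m → ℕ → Snapshot m
      charged σ c = record σ
        { outs = outs σ [ new ≔ outs σ new + sum (λ v → if below c v then arcWeight new v else 0#) ]
        ; inns = λ v → inns σ v + (if below c v then arcWeight new v else 0#) }

      charge-loop : ∀ {s σ} → s ∼ σ → ∃[ s′ ] forEachNode charge ⊢ s ⟶ s′ within (m ℕ.* 8 ℕ.+ 3) × s′ ∼ charged σ m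
      charge-loop {σ = σ} s∼σ = exec-forEachNode (λ c s → s ∼ charged σ c) ∼-frame body
        record { count≡ = count≡ s∼σ ; draws≡ = draws≡ s∼σ ; kept≡ = kept≡ s∼σ
               ; outs≡ = λ v → trans (outs≡ s∼σ v) (start v)
               ; inns≡ = λ v → trans (inns≡ s∼σ v) (sym (+-identityʳ _)) }
        where
        start : ∀ v → outs σ v ≡ outs (charged σ 0) v
        start v with v ≟ new
        ... | no  _    = refl
        ... | yes refl = sym (trans (cong (outs σ new +_) (sum-zero {m} {λ _ → 0#} λ _ → refl)) (+-identityʳ _))

        body : ∀ u {s} → nats s 0 0 ≡ toℕ u → s ∼ charged σ (toℕ u) →
          ∃[ s′ ] charge ⊢ s ⟶ s′ within 5 × nats s′ 0 0 ≡ toℕ u × s′ ∼ charged σ (suc (toℕ u))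
        body u c≡u s∼ with s′ , exec , c≡ , s′∼ ← charge-correct u c≡u s∼ = s′ , exec , c≡ , record
          { count≡ = count≡ s′∼ ; draws≡ = draws≡ s′∼ ; kept≡ = kept≡ s′∼
          ; outs≡ = λ v → trans (outs≡ s′∼ v) (advance-outs v)
          ; inns≡ = λ v → trans (inns≡ s′∼ v) (advance-inns v) }
          where
          advance-outs : ∀ v → (outs (charged σ (toℕ u)) [ new ≔ outs (charged σ (toℕ u)) new + arcWeight new u ]) v ≡
            outs (charged σ (suc (toℕ u))) v
          advance-outs v with v ≟ new
          ... | no  _ = refl
          ... | yes _ rewrite ⌊⌋-true (new ≟ new) refl = trans (+-assoc _ _ _)
            (cong (outs σ new +_) (sym (sum-insert (arcWeight new) u (<ᵇ-irrefl (toℕ u)) (<ᵇ-suc u))))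

          advance-inns : ∀ v → (inns (charged σ (toℕ u)) [ u ≔ inns (charged σ (toℕ u)) u + arcWeight new u ]) v ≡
            inns (charged σ (suc (toℕ u))) v
          advance-inns v rewrite <ᵇ-suc u v with v ≟ u
          ... | no  _    rewrite ∨-identityʳ (below (toℕ u) v) = refl
          ... | yes refl rewrite <ᵇ-irrefl (toℕ u) = cong (_+ arcWeight new u) (+-identityʳ _)

      pruned : ℕ → ℕ → Snapshot m → ℕ → Snapshot m
      pruned n k σ c = record σ
        { kept = λ v → kept σ v ∧ (if below c v then retained σ (classify n k (outs σ v) (inns σ v)) v else true) }

      prune-loop : ∀ {s σ} n k → s ∼ σ → ∃[ s′ ] forEachNode (prune n k) ⊢ s ⟶ s′ within (m ℕ.* (3 ℕ.+ (n ℕ.+ 2)) ℕ.+ 3) × s′ ∼ pruned n k σ m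
      prune-loop {σ = σ} n k s∼σ = exec-forEachNode (λ c s → s ∼ pruned n k σ c) ∼-frame body
        record { count≡ = count≡ s∼σ ; draws≡ = draws≡ s∼σ ; outs≡ = outs≡ s∼σ ; inns≡ = inns≡ s∼σ
               ; kept≡ = λ v → trans (kept≡ s∼σ v) (sym (∧-identityʳ _)) }
        where
        keep : Fin m → Bool
        keep v = retained σ (classify n k (outs σ v) (inns σ v)) v

        body : ∀ u {s} → nats s 0 0 ≡ toℕ u → s ∼ pruned n k σ (toℕ u) →
          ∃[ s′ ] prune n k ⊢ s ⟶ s′ within (n ℕ.+ 2) × nats s′ 0 0 ≡ toℕ u × s′ ∼ pruned n k σ (suc (toℕ u))
        body u c≡u s∼ with s′ , exec , c≡ , s′∼ ← prune-correct n k u c≡u s∼ = s′ , exec , c≡ , record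
          { count≡ = count≡ s′∼ ; draws≡ = draws≡ s′∼ ; outs≡ = outs≡ s′∼ ; inns≡ = inns≡ s′∼
          ; kept≡ = λ v → trans (kept≡ s′∼ v) (advance v) }
          where
          advance : ∀ v → (kept (pruned n k σ (toℕ u)) [ u ≔ kept (pruned n k σ (toℕ u)) u ∧ keep u ]) v ≡ kept (pruned n k σ (suc (toℕ u))) v
          advance v rewrite <ᵇ-suc u v with v ≟ u
          ... | no  _    rewrite ∨-identityʳ (below (toℕ u) v) = refl
          ... | yes refl rewrite <ᵇ-irrefl (toℕ u) = cong (_∧ keep u) (∧-identityʳ _)

  -- Monotonicity over time and the state between arrivals.

  0<200 : 0# < fromℕ 200
  0<200 = 0<fromℕ-suc 199

  rate-mono : ∀ {i j} → i ℕ.≤ j → rate i ≤ rate j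
  rate-mono i≤j = *-monoʳ-≤ (⁻¹-nonneg 0<200) (fromℕ-mono-≤ (selection-mono i≤j))

  classify-≥ : ∀ n k out inn → k ℕ.≤ classify n k out inn
  classify-≥ zero    k out inn = ℕ.≤-refl
  classify-≥ (suc n) k out inn with fromℕ (200 ∸ (50 ℕ.+ k)) * out ≤? fromℕ (50 ℕ.+ k) * inn
  ... | yes _ = ℕ.≤-refl
  ... | no  _ = ℕ.≤-trans (ℕ.n≤1+n k) (classify-≥ n (suc k) out inn)

  -- More incoming weight makes every test easier to pass, so the search stops no later.
  classify-antitone : ∀ n k out {inn inn′} → inn ≤ inn′ → classify n k out inn′ ℕ.≤ classify n k out inn
  classify-antitone zero    k out inn≤ = ℕ.≤-refl
  classify-antitone (suc n) k out {inn} {inn′} inn≤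
    with fromℕ (200 ∸ (50 ℕ.+ k)) * out ≤? fromℕ (50 ℕ.+ k) * inn
       | fromℕ (200 ∸ (50 ℕ.+ k)) * out ≤? fromℕ (50 ℕ.+ k) * inn′
  ... | yes _  | yes _   = ℕ.≤-refl
  ... | yes le | no  ¬le = contradiction (≤-trans le (*-monoˡ-≤ (0≤fromℕ (50 ℕ.+ k)) inn≤)) ¬le
  ... | no  _  | yes _   = ℕ.≤-trans (ℕ.n≤1+n k) (classify-≥ n (suc k) out inn)
  ... | no  _  | no  _   = classify-antitone n (suc k) out inn≤

  retained-antitone : ∀ {x i j} → i ℕ.≤ j → ⌊ x ≤? rate i ⌋ ≡ true → ⌊ x ≤? rate j ⌋ ≡ true
  retained-antitone {x} {i} {j} i≤j _ with x ≤? rate i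
  ... | yes x≤ = ⌊⌋-true (x ≤? rate j) (≤-trans x≤ (rate-mono i≤j))

  module _ {m} (G : Digraph m) where

    arcWeight-nonneg : ∀ u v → 0# ≤ arcWeight G u v
    arcWeight-nonneg u v with v ≟ u
    ... | yes _ = ≤-refl
    ... | no  _ with arcs G u v | nonneg G u v
    ...   | nothing | _       = ≤-refl
    ...   | just _  | just-all 0≤ = 0≤

    -- The weights known once `R` is revealed. The outgoing weight of a node appears all at once
    -- when it arrives, while its incoming weight grows with every arrival.
    outOf inOf : Subset m → Fin m → ℝ
    outOf R v = if lookup R v then sum (arcWeight G v) else 0#
    inOf  R v = sum λ u → if lookup R u then arcWeight G u v else 0#

    module _ (n k : ℕ) where

      -- The invariant between arrivals. Membership in the solution is expressed through the current
      -- classes alone, without reference to earlier tests; `kept-insert` shows that this survives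
      -- an arrival.
      stateOf : Subset m → ℕ → (Fin m → ℝ) → Snapshot m
      stateOf R d ρ = record
        { count = d ; draws = ρ ; outs = outOf R ; inns = inOf R
        ; kept  = λ v → lookup R v ∧ ⌊ ρ v ≤? rate (classify n k (outOf R v) (inOf R v)) ⌋ }

      module _ (ω : Tape) (R : Subset m) (new : Fin m) (new∉R : lookup R new ≡ false) where
        open Machine G ω (R ∪ ⁅ new ⁆) new

        R′ : Subset m
        R′ = R ∪ ⁅ new ⁆

        new∈R′ : lookup R′ new ≡ true
        new∈R′ = lookup-∪⁅⁆-self R new

        outOf-insert : ∀ v → (outOf R [ new ≔ outOf R new + sum (λ v → if toℕ v <ᵇ m then arcWeight G new v else 0#) ]) v ≡ outOf R′ v
        outOf-insert v rewrite lookup-∪⁅⁆ R new v with v ≟ new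
        ... | no  _    rewrite ∨-identityʳ (lookup R v) = refl
        ... | yes refl rewrite new∉R = trans (+-identityˡ _)
          (sum-cong-≗ λ v → cong (if_then arcWeight G new v else 0#) (toℕ-<ᵇ v))

        inOf-insert : ∀ v → inOf R v + (if toℕ v <ᵇ m then arcWeight G new v else 0#) ≡ inOf R′ v
        inOf-insert v = trans (cong (λ b → inOf R v + (if b then arcWeight G new v else 0#)) (toℕ-<ᵇ v))
          (sym (sum-insert (λ u → arcWeight G u v) new new∉R (lookup-∪⁅⁆ R new)))

        inOf-mono : ∀ v → inOf R v ≤ inOf R′ v
        inOf-mono v = subst₂ _≤_ (+-identityʳ _) (trans (cong (λ b → inOf R v + (if b then arcWeight G new v else 0#)) (sym (toℕ-<ᵇ v))) (inOf-insert v))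
          (+-mono-≤ ≤-refl (arcWeight-nonneg new v))

        arrival-correct : ∀ {s d ρ} → s ∼ stateOf R d ρ →
          ∃[ s′ ] (draw 0 arriving ⨾ forEachNode charge ⨾ forEachNode (prune n k)) ⊢ insert new s ⟶ s′
            within (suc (suc (suc ((m ℕ.* 8 ℕ.+ 3) ℕ.+ (m ℕ.* (3 ℕ.+ (n ℕ.+ 2)) ℕ.+ 3))))) ×
            s′ ∼ stateOf R′ (suc d) (ρ [ new ≔ UnitReal.value (ω d) ])
        arrival-correct {s} {d} {ρ} s∼ = 
          let s₂ , exec₂ , s₂∼ = charge-loop G ω R′ new new∈R′ {record (insert new s) { reals = update (reals s) 0 (toℕ new) (UnitReal.value (ω (drawn s))) ; drawn = suc (drawn s) }} {σ₁} s₁∼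
              s₃ , exec₃ , s₃∼ = prune-loop G ω R′ new new∈R′ n k s₂∼
          in s₃ , exec-⨾ (exec-step (λ _ → refl)) (exec-⨾ exec₂ exec₃) , record
            { count≡ = count≡ s₃∼
            ; draws≡ = draws≡ s₃∼
            ; outs≡  = λ v → trans (outs≡ s₃∼ v) (outOf-insert v)
            ; inns≡  = λ v → trans (inns≡ s₃∼ v) (inOf-insert v)
            ; kept≡  = λ v → trans (kept≡ s₃∼ v) (kept-insert v)
            }
          where
          ρ′ : Fin m → ℝ
          ρ′ = ρ [ new ≔ UnitReal.value (ω d) ]

          old now : Fin m → Bool
          old  v = ⌊ ρ v ≤? rate (classify n k (outOf R v) (inOf R v)) ⌋
          now v = ⌊ ρ′ v ≤? rate (classify n k (outOf R′ v) (inOf R′ v)) ⌋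

          -- The state after `new` has been inserted and its number drawn, but before any weight is
          -- charged: `kept` still refers to the old draws and classes.
          σ₁ : Snapshot m
          σ₁ = record (stateOf R (suc d) ρ′) { kept = λ v → (lookup R v ∧ old v) ∨ ⌊ v ≟ new ⌋ }

          s₁∼ : record (insert new s) { reals = update (reals s) 0 (toℕ new) (UnitReal.value (ω (drawn s))) ; drawn = suc (drawn s) } ∼ σ₁
          s₁∼ = record
            { count≡ = cong suc (count≡ s∼)
            ; draws≡ = λ v → trans (update-toℕ (reals s) 0 new _ v refl)
                (cong₂ (λ x y → if ⌊ v ≟ new ⌋ then x else y) (cong (λ d → UnitReal.value (ω d)) (count≡ s∼)) (draws≡ s∼ v))
            ; outs≡  = outs≡ s∼
            ; inns≡  = inns≡ s∼
            ; kept≡  = λ v → trans (lookup-∪⁅⁆ (solution s) new v) (cong (_∨ ⌊ v ≟ new ⌋) (kept≡ s∼ v))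
            }

          absorb : ∀ a b c d → (a ≡ true → d ≡ true → b ≡ true) → c ≡ false → ((a ∧ b) ∨ c) ∧ d ≡ (a ∨ c) ∧ d
          absorb false b c d     _ refl = refl
          absorb true  b c false _ refl = trans (∧-zeroʳ _) refl
          absorb true  b c true  d⇒b refl rewrite d⇒b refl refl = refl

          -- Classes only decrease over time, so a node that passes the test now has passed every
          -- earlier one.
          kept-insert : ∀ v → kept (pruned G ω R′ new new∈R′ n k (charged G ω R′ new new∈R′ σ₁ m) m) v ≡ lookup R′ v ∧ now v
          kept-insert v = trans (cong₂ (λ b c → ((lookup R v ∧ old v) ∨ ⌊ v ≟ new ⌋) ∧ (if b then c else true)) (toℕ-<ᵇ v)
              (cong₂ (λ x y → ⌊ ρ′ v ≤? rate (classify n k x y) ⌋) (outOf-insert v) (inOf-insert v)))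
            (trans (merge (v ≟ new)) (cong (_∧ now v) (sym (lookup-∪⁅⁆ R new v))))
            where
            merge : (v≟new : Dec (v ≡ new)) → ((lookup R v ∧ old v) ∨ ⌊ v≟new ⌋) ∧ now v ≡ (lookup R v ∨ ⌊ v≟new ⌋) ∧ now v
            merge (yes _)     = cong (_∧ now v) (trans (∨-zeroʳ _) (sym (∨-zeroʳ _)))
            merge (no v≢new) = absorb (lookup R v) (old v) false (now v) (λ v∈R now-true →
              retained-antitone (classify-antitone n k (outOf R v) (inOf-mono v))
                (trans (cong₂ (λ x y → ⌊ x ≤? rate (classify n k y (inOf R′ v)) ⌋) ρ≡ (out≡ v∈R)) now-true)) refl
              where
              ρ≡ : ρ v ≡ ρ′ v
              ρ≡ = cong (if_then UnitReal.value (ω d) else ρ v) (sym (⌊⌋-false (v ≟ new) v≢new))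

              out≡ : lookup R v ≡ true → outOf R v ≡ outOf R′ v
              out≡ v∈R = cong (if_then sum (arcWeight G v) else 0#)
                (trans v∈R (sym (trans (lookup-∪⁅⁆ R new v) (cong (_∨ ⌊ v ≟ new ⌋) v∈R))))

-- Competitive ratio and running time

Unique⇒lookup-injective : ∀ {m} {us : List (Fin m)} → Unique us → ∀ {i j} → List.lookup us i ≡ List.lookup us j → i ≡ j
Unique⇒lookup-injective (u∉ ∷ _)  {zero}  {zero}  _  = refl
Unique⇒lookup-injective (u∉ ∷ _)  {zero}  {suc j} eq = contradiction eq (All.lookup u∉ (∈-lookup j))
Unique⇒lookup-injective (u∉ ∷ _)  {suc i} {zero}  eq = contradiction (sym eq) (All.lookup u∉ (∈-lookup i))
Unique⇒lookup-injective (_ ∷ us!) {suc i} {suc j} eq = cong suc (Unique⇒lookup-injective us! eq)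

Unique⇒length≤ : ∀ {m} {us : List (Fin m)} → Unique us → length us ℕ.≤ m
Unique⇒length≤ us! = injective⇒≤ (Unique⇒lookup-injective us!)

revealedAfter : ∀ {m} → Subset m → List (Fin m) → Subset m
revealedAfter R []       = R
revealedAfter R (u ∷ us) = revealedAfter (R ∪ ⁅ u ⁆) us

revealedAfter-⊇ : ∀ {m} (R : Subset m) us {v} → lookup R v ≡ true → lookup (revealedAfter R us) v ≡ true
revealedAfter-⊇ R []       v∈R = v∈R
revealedAfter-⊇ R (u ∷ us) {v} v∈R = revealedAfter-⊇ (R ∪ ⁅ u ⁆) us (trans (lookup-∪⁅⁆ R u v) (cong (_∨ ⌊ v ≟ u ⌋) v∈R))

revealedAfter⁺ : ∀ {m} (R : Subset m) {us v} → v ∈ˡ us → lookup (revealedAfter R us) v ≡ true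
revealedAfter⁺ R {u ∷ us} (here refl)  = revealedAfter-⊇ (R ∪ ⁅ u ⁆) us (lookup-∪⁅⁆-self R u)
revealedAfter⁺ R {u ∷ us} (there v∈us) = revealedAfter⁺ (R ∪ ⁅ u ⁆) v∈us

revealedAfter⁻ : ∀ {m} (R : Subset m) us {v} → lookup (revealedAfter R us) v ≡ true → lookup R v ≡ true ⊎ v ∈ˡ us
revealedAfter⁻ R []       v∈ = inj₁ v∈
revealedAfter⁻ R (u ∷ us) {v} v∈ with v ≟ u | revealedAfter⁻ (R ∪ ⁅ u ⁆) us v∈
... | yes refl | _         = inj₂ (here refl)
... | no  _    | inj₂ v∈us = inj₂ (there v∈us)
... | no  v≢u  | inj₁ v∈R  = inj₁ (trans (sym (lookup-∪⁅⁆-other R v≢u)) v∈R)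

revealedAfter-∅⁻ : ∀ {m} (us : List (Fin m)) {v} → lookup (revealedAfter ∅ us) v ≡ true → v ∈ˡ us
revealedAfter-∅⁻ us {v} v∈ = [ (λ v∈∅ → contradiction (trans (sym v∈∅) (lookup-replicate v false)) λ ()) , (λ v∈us → v∈us) ]′
  (revealedAfter⁻ ∅ us v∈)

module Guarantee (ℛ : RealNumbers) where
  open OrderedField ℛ
  open Solver using (solve; _:=_; _:+_; _:*_; _:-_; :-_; con)
  open Dicut ℛ
  open Digraph
  open Store
  open UnitReal
  open Expectation ℛ
  open Execution ℛ
  open Bias ℛ
  open Algorithm ℛ
  open Snapshot
  open _∼_

  -- Processing the whole sequence of arrivals.

  drawsAfter : ∀ {m} → Tape → ℕ → (Fin m → ℝ) → List (Fin m) → Fin m → ℝ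
  drawsAfter ω d ρ []       = ρ
  drawsAfter ω d ρ (u ∷ us) = drawsAfter ω (suc d) (ρ [ u ≔ value (ω d) ]) us

  countAfter : ∀ {m} → ℕ → List (Fin m) → ℕ
  countAfter d []       = d
  countAfter d (u ∷ us) = countAfter (suc d) us

  -- Every arrival charges the outgoing arcs of its node, so the invariant is preserved only if the
  -- node was not revealed before. Distinctness of the arrivals supplies this.
  Fresh : ∀ {m} → Subset m → List (Fin m) → Set
  Fresh R = All (λ v → lookup R v ≡ false)

  Fresh-insert : ∀ {m} (R : Subset m) {u us} → All (u ≢_) us → Fresh R us → Fresh (R ∪ ⁅ u ⁆) us
  Fresh-insert R []              []             = []
  Fresh-insert R (u≢v ∷ u∉us) (v∉R ∷ fresh) =
    trans (lookup-∪⁅⁆-other R (u≢v ∘ sym)) v∉R ∷ Fresh-insert R u∉us fresh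

  timePerArrival : ℕ → ℕ → ℕ
  timePerArrival m n = suc (suc (suc ((m ℕ.* 8 ℕ.+ 3) ℕ.+ (m ℕ.* (3 ℕ.+ (n ℕ.+ 2)) ℕ.+ 3))))

  module _ {m} (G : Digraph m) (n k : ℕ) where

    online-correct : ∀ ω us {R s d ρ} → Unique us → Fresh R us → s ∼ stateOf G n k R d ρ →
      ∃[ t ] ∃[ s′ ] Online (draw 0 arriving ⨾ forEachNode charge ⨾ forEachNode (prune n k)) G ω R s us t s′ ×
        t ℕ.≤ length us ℕ.* timePerArrival m n ×
        s′ ∼ stateOf G n k (revealedAfter R us) (countAfter d us) (drawsAfter ω d ρ us)
    online-correct ω []       _           _             s∼ = 0 , _ , end , z≤n , s∼
    online-correct ω (u ∷ us) {R} {d = d} {ρ} (u∉us ∷ us!) (u∉R ∷ fresh) s∼ = continue (arrival-correct G n k ω R u u∉R s∼)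
      where
      A = draw 0 arriving ⨾ forEachNode charge ⨾ forEachNode (prune n k)
      ρ′ = ρ [ u ≔ value (ω d) ]
      open Machine G ω (R ∪ ⁅ u ⁆) u

      continue : ∃[ s₁ ] A ⊢ insert u _ ⟶ s₁ within timePerArrival m n × s₁ ∼ stateOf G n k (R ∪ ⁅ u ⁆) (suc d) ρ′ →
        ∃[ t ] ∃[ s′ ] Online A G ω R _ (u ∷ us) t s′ × t ℕ.≤ timePerArrival m n ℕ.+ length us ℕ.* timePerArrival m n ×
          s′ ∼ stateOf G n k (revealedAfter (R ∪ ⁅ u ⁆) us) (countAfter (suc d) us) (drawsAfter ω (suc d) ρ′ us)
      continue (s₁ , exec , s₁∼)
        -- The empty continuation halts in 0 steps, which turns the execution statement into an
        -- actual run.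
        with t₁ , halts , t₁≤ ← exec {[]} {0} halt
        with t₂ , s₂ , online , t₂≤ , s₂∼ ← online-correct ω us us! (Fresh-insert R u∉us fresh) s₁∼ =
        t₁ ℕ.+ t₂ , s₂ , arrive halts online ,
        ℕ.+-mono-≤ (ℕ.≤-trans t₁≤ (ℕ.≤-reflexive (ℕ.+-identityʳ _))) t₂≤ , s₂∼

  -- Relates the draws stored by the machine to `selected`, which reads its tape from position 0.
  -- The tape τ is ω with the first `d` draws removed. Nodes already in `R` keep their stored draw
  -- in ρ, because later arrivals are fresh.
  kept≡selected : ∀ {m} (x : Fin m → ℝ) us {R ω τ d ρ} → Unique us → Fresh R us → (∀ i → τ i ≡ ω (i ℕ.+ d)) → ∀ v →
    lookup (revealedAfter R us) v ∧ ⌊ drawsAfter ω d ρ us v ≤? x v ⌋ ≡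
    (if lookup R v then ⌊ ρ v ≤? x v ⌋ else selected x us τ v)
  kept≡selected x [] {R} _ _ _ v with lookup R v
  ... | true  = refl
  ... | false = refl
  kept≡selected x (u ∷ us) {R} {ω} {τ} {d} {ρ} (u∉us ∷ us!) (u∉R ∷ fresh) τ≡ v = trans
    (kept≡selected x us us! (Fresh-insert R u∉us fresh) (λ i → trans (τ≡ (suc i)) (cong ω (sym (ℕ.+-suc i d)))) v)
    shift
    where
    shift : (if lookup (R ∪ ⁅ u ⁆) v then ⌊ (ρ [ u ≔ value (ω d) ]) v ≤? x v ⌋ else selected x us (τ ∘ suc) v) ≡
      (if lookup R v then ⌊ ρ v ≤? x v ⌋ else selected x (u ∷ us) τ v)
    shift rewrite lookup-∪⁅⁆ R u v with v ≟ u
    ... | yes refl rewrite u∉R = cong (λ r → ⌊ value r ≤? x v ⌋) (sym (τ≡ 0))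
    ... | no  _    rewrite ∨-identityʳ (lookup R v) = refl

  mean-∈ : ∀ {m} (x : Fin m → ℝ) {us v} → v ∈ˡ us → mean x us v ≡ x v
  mean-∈ x {u ∷ us} {v} v∈ with v ≟ u | v∈
  ... | yes refl | _          = refl
  ... | no  v≢u  | here v≡u   = contradiction v≡u v≢u
  ... | no  _    | there v∈us = mean-∈ x v∈us

  mean-∉ : ∀ {m} (x : Fin m → ℝ) us {v} → ¬ v ∈ˡ us → mean x us v ≡ 0#
  mean-∉ x []       v∉ = refl
  mean-∉ x (u ∷ us) {v} v∉ with v ≟ u
  ... | yes refl = contradiction (here refl) v∉
  ... | no  _    = mean-∉ x us (v∉ ∘ there)

  -- At a node that never arrives `mean` is zero, and the hypothesis makes `x` zero there. The final
  -- rates satisfy it by `rate-unrevealed`.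
  mean≡ : ∀ {m} (x : Fin m → ℝ) us → (∀ v → lookup (revealedAfter ∅ us) v ≡ false → x v ≡ 0#) → ∀ v → mean x us v ≡ x v
  mean≡ x us x≡0 v with lookup (revealedAfter ∅ us) v in v∈
  ... | true  = mean-∈ x (revealedAfter-∅⁻ us v∈)
  ... | false = trans (mean-∉ x us λ v∈us → contradiction (trans (sym (revealedAfter⁺ ∅ v∈us)) v∈) λ ()) (sym (x≡0 v v∈))

  -- Rates and correctness of the classes.

  0≤rate : ∀ k → 0# ≤ rate k
  0≤rate k = *-nonneg (0≤fromℕ (selection k)) (⁻¹-nonneg 0<200)

  200*rate : ∀ k → fromℕ 200 * rate k ≡ fromℕ (selection k)
  200*rate k = *-/-cancel (proj₂ 0<200)

  rate≤1 : ∀ k → rate k ≤ 1#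
  rate≤1 k = *-cancelˡ-≤ 0<200 (subst₂ _≤_ (sym (200*rate k)) (sym (*-identityʳ _)) (fromℕ-mono-≤ (selection≤200 k)))

  rate-0 : rate 0 ≡ 0#
  rate-0 = zeroˡ _

  -- Without outgoing weight the first test succeeds, even if the incoming weight is also zero,
  -- since the tests involve no division. Hence unrevealed nodes land in class 0, where the rate is
  -- 0.
  classify-0 : ∀ n k {inn} → 0# ≤ inn → classify (suc n) k 0# inn ≡ k
  classify-0 n k {inn} 0≤inn = cong (if_then k else classify n (suc k) 0# inn)
    (⌊⌋-true (_ ≤? _) (subst (_≤ fromℕ (50 ℕ.+ k) * inn) (sym (zeroʳ _)) (*-nonneg (0≤fromℕ (50 ℕ.+ k)) 0≤inn)))

  upper-< : ∀ n k → suc n ℕ.+ k ≡ 101 → upper k ≡ 50 ℕ.+ k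
  upper-< n k 1+n+k≡101 = cong (if_then 50 ℕ.+ k else 200)
    (Equivalence.to T-≡ (ℕ.<⇒<ᵇ {k} {101} (subst (k ℕ.<_) 1+n+k≡101 (s≤s (ℕ.m≤n+m k n)))))

  -- A failed test for the upper end of class `k` is, by totality, the lower bound of class `suc k`,
  -- as both ends are `50 ℕ.+ k`. In the top class the upper end is 200, and its bound reads 0 ≤ 200
  -- · `inn`.
  classify-correct : ∀ n k {out inn} → n ℕ.+ k ≡ 101 → 0# ≤ inn →
    fromℕ (lower k) * inn ≤ fromℕ (200 ∸ lower k) * out →
    InClass (classify n k out inn) out inn × classify n k out inn ℕ.< 102
  classify-correct zero    k {out} {inn} refl 0≤inn lower≤ = (lower≤ ,
    subst (_≤ fromℕ 200 * inn) (sym (zeroˡ out)) (*-nonneg (0≤fromℕ 200) 0≤inn)) , ℕ.≤-refl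
  classify-correct (suc n) k {out} {inn} 1+n+k≡101 0≤inn lower≤
    with fromℕ (200 ∸ (50 ℕ.+ k)) * out ≤? fromℕ (50 ℕ.+ k) * inn
  ... | yes ≤upper = (lower≤ , subst (λ h → fromℕ (200 ∸ h) * out ≤ fromℕ h * inn) (sym (upper-< n k 1+n+k≡101)) ≤upper) ,
    s≤s (subst (k ℕ.≤_) 1+n+k≡101 (ℕ.m≤n+m k (suc n)))
  ... | no  ≰upper = classify-correct n (suc k) (trans (ℕ.+-suc n k) 1+n+k≡101) 0≤inn (≰⇒≥ ≰upper)

  sum-affine : ∀ {m p} {f g h : Fin m → ℝ} → (∀ v → f v ≡ p * g v + (1# − p) * h v) → sum f ≡ p * sum g + (1# − p) * sum h
  sum-affine {p = p} {f} {g} {h} f≡ = trans (sum-cong-≗ f≡) $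
    trans (∑-distrib-+ (λ v → p * g v) (λ v → (1# − p) * h v)) $
    sym (cong₂ _+_ (*-distribˡ-sum p g) (*-distribˡ-sum (1# − p) h))

  -- Expected cut of independent rounding.

  module _ {m} (W : Fin m → Fin m → ℝ) (no-loops : ∀ u → W u u ≡ 0#) where
    open Weighted W

    expectedCut : (Fin m → ℝ) → ℝ
    expectedCut y = total λ u v → y u * (1# − y v)

    -- An arc between distinct nodes has at most one factor involving the updated coordinate. Only a
    -- loop would be quadratic in it, and loops have weight zero.
    expectedCut-affine : MultiAffine expectedCut
    expectedCut-affine = record
      { cong-F = λ y≗z → total-cong λ u v → cong₂ (λ a b → a * (1# − b)) (y≗z u) (y≗z v)
      ; affine = λ w y p → sum-affine λ u → sum-affine λ v → affine-arc w y p u v }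
      where
      affine-arc : ∀ w y p u v →
        W u v * ((y [ w ≔ p ]) u * (1# − (y [ w ≔ p ]) v)) ≡
        p * (W u v * ((y [ w ≔ 1# ]) u * (1# − (y [ w ≔ 1# ]) v))) +
        (1# − p) * (W u v * ((y [ w ≔ 0# ]) u * (1# − (y [ w ≔ 0# ]) v)))
      affine-arc w y p u v with u ≟ w | v ≟ w
      ... | yes refl | yes refl rewrite no-loops u =
        solve 1 (λ p → con (pos 0) :* (p :* (con (pos 1) :- p)) :=
          p :* (con (pos 0) :* (con (pos 1) :* (con (pos 1) :- con (pos 1)))) :+
          (con (pos 1) :- p) :* (con (pos 0) :* (con (pos 0) :* (con (pos 1) :- con (pos 0))))) refl p
      ... | yes _ | no _ =
        solve 3 (λ p a b → a :* (p :* (con (pos 1) :- b)) :=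
          p :* (a :* (con (pos 1) :* (con (pos 1) :- b))) :+
          (con (pos 1) :- p) :* (a :* (con (pos 0) :* (con (pos 1) :- b)))) refl p (W u v) (y v)
      ... | no _ | yes _ =
        solve 3 (λ p a b → a :* (b :* (con (pos 1) :- p)) :=
          p :* (a :* (b :* (con (pos 1) :- con (pos 1)))) :+
          (con (pos 1) :- p) :* (a :* (b :* (con (pos 1) :- con (pos 0))))) refl p (W u v) (y u)
      ... | no _ | no _ =
        solve 2 (λ p a → a := p :* a :+ (con (pos 1) :- p) :* a) refl p (W u v * (y u * (1# − y v)))

  module _ {m} (G : Digraph m) (R : Subset m) where

    visible : Fin m → Fin m → ℝ
    visible u v = if lookup R u then arcWeight G u v else 0#

    open Weighted visible

    visible-nonneg : ∀ u v → 0# ≤ visible u v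
    visible-nonneg u v with lookup R u
    ... | true  = arcWeight-nonneg G u v
    ... | false = ≤-refl

    visible-no-loops : ∀ u → visible u u ≡ 0#
    visible-no-loops u with lookup R u
    ... | false = refl
    ... | true  = cong (if_then 0# else fromMaybe 0# (arcs G u u)) (⌊⌋-true (u ≟ u) refl)

    outWeight≡outOf : ∀ v → outWeight v ≡ outOf G R v
    outWeight≡outOf v with lookup R v
    ... | true  = refl
    ... | false = sum-zero {m} {λ _ → 0#} λ _ → refl

    -- An arc cut by a subset of `R` leaves a revealed node and is not a loop, so restricting to
    -- visible arcs loses nothing.
    cut≡expectedCut : ∀ S → (∀ u → lookup S u ≡ true → lookup R u ≡ true) →
      cut G S ≡ expectedCut visible visible-no-loops (indicator ∘ lookup S)
    cut≡expectedCut S S⊆R = sum-cong-≗ λ u → sum-cong-≗ λ v → contribution u v (lookup S u) (lookup S v) refl refl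
      where
      contribution : ∀ u v a b → lookup S u ≡ a → lookup S v ≡ b →
        (if a ∧ not b then fromMaybe 0# (arcs G u v) else 0#) ≡ visible u v * (indicator a * (1# − indicator b))
      contribution u v false b _ _ = solve 2 (λ w b → con (pos 0) := w :* (con (pos 0) :* (con (pos 1) :- b))) refl (visible u v) (indicator b)
      contribution u v true true _ _ = solve 1 (λ w → con (pos 0) := w :* (con (pos 1) :* (con (pos 1) :- con (pos 1)))) refl (visible u v)
      contribution u v true false u∈S v∉S = trans weight≡ (solve 1 (λ w → w := w :* (con (pos 1) :* (con (pos 1) :- con (pos 0)))) refl (visible u v))
        where
        v≢u : v ≢ u
        v≢u refl with () ← trans (sym u∈S) v∉S

        weight≡ : fromMaybe 0# (arcs G u v) ≡ visible u v
        weight≡ rewrite S⊆R u u∈S = cong (if_then 0# else fromMaybe 0# (arcs G u v)) (sym (⌊⌋-false (v ≟ u) v≢u))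

    class : Fin m → ℕ
    class v = classify 101 0 (outOf G R v) (inOf G R v)

    class-correct : ∀ v → InClass (class v) (outOf G R v) (inOf G R v) × class v ℕ.< 102
    class-correct v = classify-correct 101 0 refl (sum-nonneg λ u → visible-nonneg u v)
      -- Since `lower 0` is 0, the search starts from a lower bound that holds trivially.
      (subst (_≤ fromℕ 200 * outOf G R v) (sym (zeroˡ _))
        (*-nonneg (0≤fromℕ 200) (subst (0# ≤_) (outWeight≡outOf v) (sum-nonneg (visible-nonneg v)))))

    rate-unrevealed : ∀ v → lookup R v ≡ false → rate (class v) ≡ 0#
    rate-unrevealed v v∉R = trans (cong rate (trans
      (cong (λ b → classify 101 0 (if b then sum (arcWeight G v) else 0#) (inOf G R v)) v∉R)
      (classify-0 100 0 (sum-nonneg λ u → visible-nonneg u v)))) rate-0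

    approximation : ∀ S → (∀ u → lookup S u ≡ true → lookup R u ≡ true) →
      fromℕ 483 * cut G S ≤ fromℕ 1000 * expectedCut visible visible-no-loops (rate ∘ class)
    -- The cancelled factor is 40: 19320 = 40 · 483 and 200² = 40 · 1000.
    approximation S S⊆R = *-cancelˡ-≤ (0<fromℕ-suc 39) $ subst₂ _≤_
      (trans (cong₂ _*_ (fromℕ-* 40 483) (trans (total-cong λ u v → fromℕ-crossing (lookup S u) (lookup S v)) (sym (cut≡expectedCut S S⊆R)))) (*-assoc _ _ _))
      (begin
        total (λ u v → fromℕ (selection (class u) ℕ.* (200 ∸ selection (class v))))
          ≡⟨ total-cong (λ u v → scaled (class u) (class v)) ⟩
        total (λ u v → fromℕ 200 * fromℕ 200 * (rate (class u) * (1# − rate (class v))))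
          ≡⟨ total-* (fromℕ 200 * fromℕ 200) (λ u v → rate (class u) * (1# − rate (class v))) ⟩
        fromℕ 200 * fromℕ 200 * e
          ≡⟨ cong (_* e) (trans (sym (fromℕ-* 200 200)) (fromℕ-* 40 1000)) ⟩
        fromℕ 40 * fromℕ 1000 * e
          ≡⟨ *-assoc _ _ _ ⟩
        fromℕ 40 * (fromℕ 1000 * e) ∎)
      (scaledCut≤scaledValue visible visible-nonneg class (proj₂ ∘ class-correct)
        (λ v → subst (λ out → InClass (class v) out (inOf G R v)) (sym (outWeight≡outOf v)) (proj₁ (class-correct v)))
        (lookup S))
      where
      open ≡-Reasoning
      e = expectedCut visible visible-no-loops (rate ∘ class)

      fromℕ-crossing : ∀ a b → fromℕ (crossing a b) ≡ indicator a * (1# − indicator b)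
      fromℕ-crossing true  true  = solve 0 (con (pos 0) := con (pos 1) :* (con (pos 1) :- con (pos 1))) refl
      fromℕ-crossing true  false = solve 0 (con (pos 1) :+ con (pos 0) := con (pos 1) :* (con (pos 1) :- con (pos 0))) refl
      fromℕ-crossing false b     = sym (zeroˡ _)

      scaled : ∀ i j → fromℕ (selection i ℕ.* (200 ∸ selection j)) ≡ fromℕ 200 * fromℕ 200 * (rate i * (1# − rate j))
      scaled i j = begin
        fromℕ (selection i ℕ.* (200 ∸ selection j))
          ≡⟨ fromℕ-* (selection i) _ ⟩
        fromℕ (selection i) * fromℕ (200 ∸ selection j)
          ≡⟨ cong₂ (λ x y → x * y) (sym (200*rate i)) (trans (fromℕ-∸ (selection≤200 j)) (cong (fromℕ 200 −_) (sym (200*rate j)))) ⟩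
        fromℕ 200 * rate i * (fromℕ 200 − fromℕ 200 * rate j)
          ≡⟨ solve 3 (λ c x y → c :* x :* (c :- c :* y) := c :* c :* (x :* (con (pos 1) :- y))) refl (fromℕ 200) (rate i) (rate j) ⟩
        fromℕ 200 * fromℕ 200 * (rate i * (1# − rate j)) ∎

  -- Conclusion for a given instance.

  maximum : ∀ m (f : Subset m → ℝ) → ∃[ S ] ∀ S′ → f S′ ≤ f S
  maximum zero    f = [] , λ { [] → ≤-refl }
  maximum (suc m) f with maximum m (f ∘ (true ∷_)) | maximum m (f ∘ (false ∷_))
  ... | S₁ , max₁ | S₀ , max₀ with ≤-total (f (true ∷ S₁)) (f (false ∷ S₀))
  ...   | inj₁ S₁≤S₀ = false ∷ S₀ , λ { (true ∷ S) → ≤-trans (max₁ S) S₁≤S₀ ; (false ∷ S) → max₀ S }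
  ...   | inj₂ S₀≤S₁ = true ∷ S₁ , λ { (true ∷ S) → max₁ S ; (false ∷ S) → ≤-trans (max₀ S) S₀≤S₁ }

  finalState : ∀ (I : Instance) → Tape → Snapshot (Instance.size I)
  finalState I ω = stateOf graph 101 0 (revealedAfter ∅ arrivals) (countAfter 0 arrivals) (drawsAfter ω 0 (λ _ → 0#) arrivals)
    where open Instance I

  run : ∀ I ω → let open Instance I in
    ∃[ t ] ∃[ s ] Runs algorithm I ω t s × t ℕ.≤ length arrivals ℕ.* timePerArrival size 101 × s ∼ finalState I ω
  run I ω = online-correct graph 101 0 ω arrivals distinct (All.tabulate λ {v} _ → lookup-replicate v false) record
    { count≡ = refl
    ; draws≡ = λ v → refl
    ; outs≡  = λ v → cong (if_then sum (arcWeight graph v) else 0#) (sym (lookup-replicate v false))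
    ; inns≡  = λ v → sym (sum-zero λ u → cong (if_then arcWeight graph u v else 0#) (lookup-replicate u false))
    ; kept≡  = λ v → trans (lookup-replicate v false) (∧-falseˡ (lookup-replicate v false))
    }
    where
    open Instance I
    ∧-falseˡ : ∀ {a b} → a ≡ false → false ≡ a ∧ b
    ∧-falseˡ refl = refl

  polynomialTime : PolynomialTime algorithm
  -- With m nodes there are at most m arrivals of at most 114 m + 9 steps each, and 114 m² + 9 m ≤
  -- 123 m².
  polynomialTime = 123 , 2 , λ I ω → bounded I (run I ω)
    where
    m≤m² : ∀ m → m ℕ.≤ m ℕ.^ 2
    m≤m² zero    = z≤n
    m≤m² (suc m) = ℕ.m≤m*n (suc m) (suc m ℕ.* 1)
    bounded : ∀ I {ω} → (∃[ t ] ∃[ s ] Runs algorithm I ω t s × t ℕ.≤ length (Instance.arrivals I) ℕ.* timePerArrival (Instance.size I) 101 × s ∼ finalState I ω) →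
      ∃[ t ] ∃[ s ] Runs algorithm I ω t s × t ℕ.≤ 123 ℕ.* Instance.size I ℕ.^ 2 ℕ.+ 123
    bounded I (t , s , runs , t≤ , _) = t , s , runs , ℕ.≤-trans t≤ (ℕ.≤-trans
      (ℕ.*-monoˡ-≤ (timePerArrival size 101) (Unique⇒length≤ distinct)) (ℕ.≤-trans (ℕ.≤-reflexive (expand size)) (ℕ.≤-trans
      (ℕ.+-monoʳ-≤ (114 ℕ.* size ℕ.^ 2) (ℕ.*-monoʳ-≤ 9 (m≤m² size))) (ℕ.≤-trans (ℕ.≤-reflexive (collect (size ℕ.^ 2))) (ℕ.m≤m+n _ 123)))))
      where
      open Instance I
      expand : ∀ m → m ℕ.* (3 ℕ.+ ((m ℕ.* 8 ℕ.+ 3) ℕ.+ (m ℕ.* 106 ℕ.+ 3))) ≡ 114 ℕ.* (m ℕ.* (m ℕ.* 1)) ℕ.+ 9 ℕ.* m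
      expand = ℕSolver.solve-∀
      collect : ∀ q → 114 ℕ.* q ℕ.+ 9 ℕ.* q ≡ 123 ℕ.* q
      collect = ℕSolver.solve-∀

  competitive : Competitive algorithm (fromℕ 483 / fromℕ 1000)
  competitive I = S , e , o , outputs , expectation , ((optimum , optimum-feasible , refl) , optimum-optimal) , ratio
    where
    open Instance I
    R : Subset size
    R = revealedAfter ∅ arrivals

    x : Fin size → ℝ
    x = rate ∘ class graph R

    F : (Fin size → ℝ) → ℝ
    F = expectedCut (visible graph R) (visible-no-loops graph R)

    F-affine : MultiAffine F
    F-affine = expectedCut-affine (visible graph R) (visible-no-loops graph R)

    S : Tape → Subset size
    S ω = tabulate (selected x arrivals ω)

    e : ℝ
    e = F x

    finallyKept≡ : ∀ ω v → kept (finalState I ω) v ≡ selected x arrivals ω v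
    finallyKept≡ ω v = trans
      (kept≡selected x arrivals distinct (All.tabulate λ {u} _ → lookup-replicate u false) (λ i → cong ω (sym (ℕ.+-identityʳ i))) v)
      (cong (if_then ⌊ 0# ≤? x v ⌋ else selected x arrivals ω v) (lookup-replicate v false))

    outputs : Outputs algorithm I S
    outputs ω = output (run I ω)
      where
      output : (∃[ t ] ∃[ s ] Runs algorithm I ω t s × t ℕ.≤ length arrivals ℕ.* timePerArrival size 101 × s ∼ finalState I ω) →
        ∃[ t ] ∃[ s ] Runs algorithm I ω t s × solution s ≡ S ω
      output (t , s , runs , _ , s∼) = t , s , runs ,
        trans (sym (tabulate∘lookup (solution s))) (tabulate-cong λ v → trans (kept≡ s∼ v) (finallyKept≡ ω v))

    S⊆R : ∀ ω u → lookup (S ω) u ≡ true → lookup R u ≡ true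
    S⊆R ω u u∈S = ∧-trueˡ (trans (finallyKept≡ ω u) (trans (sym (lookup∘tabulate (selected x arrivals ω) u)) u∈S))
      where
      ∧-trueˡ : ∀ {a b} → a ∧ b ≡ true → a ≡ true
      ∧-trueˡ {true} _ = refl

    expectation : IsExpectation (λ ω → cut graph (S ω)) e
    expectation = IsExpectation-cong
      (λ ω → sym (trans (cut≡expectedCut graph R (S ω) (S⊆R ω))
        (MultiAffine.cong-F F-affine λ v → cong indicator (lookup∘tabulate (selected x arrivals ω) v))))
      (subst (IsExpectation _) (MultiAffine.cong-F F-affine (mean≡ x arrivals (rate-unrevealed graph R)))
        (expectation-selected (λ v → 0≤rate (class graph R v) , rate≤1 (class graph R v)) F-affine arrivals))

    -- The feasible sets are exactly the subsets of `R`, so intersecting with `R` reduces the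
    -- constrained maximum to one over all subsets.
    largest : ∃[ S ] ∀ S′ → cut graph (S′ ∩ R) ≤ cut graph (S ∩ R)
    largest = maximum size λ S → cut graph (S ∩ R)

    optimum : Subset size
    optimum = proj₁ largest ∩ R

    o : ℝ
    o = cut graph optimum

    optimum⊆R : ∀ {v} → v ∈ optimum → v ∈ R
    optimum⊆R v∈optimum = proj₂ (x∈p∩q⁻ (proj₁ largest) R v∈optimum)

    optimum-feasible : Feasible optimum
    optimum-feasible v∈optimum = revealedAfter-∅⁻ arrivals ([]=⇒lookup (optimum⊆R v∈optimum))

    optimum-optimal : ∀ S → Feasible S → cut graph S ≤ o
    optimum-optimal S S-feasible = subst (λ S → cut graph S ≤ o)
      (⊆-antisym (p∩q⊆p S R) λ v∈S → x∈p∩q⁺ (v∈S , lookup⇒[]= _ R (revealedAfter⁺ ∅ (S-feasible v∈S))))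
      (proj₂ largest S)

    ratio : fromℕ 483 / fromℕ 1000 * o ≤ e
    ratio = *-cancelˡ-≤ 0<1000 $ subst (_≤ fromℕ 1000 * e)
      (trans (cong (_* o) (sym (*-/-cancel (proj₂ 0<1000)))) (*-assoc _ _ _))
      (approximation graph R optimum λ u u∈optimum → []=⇒lookup (optimum⊆R (lookup⇒[]= u optimum u∈optimum)))
      where
      0<1000 : 0# < fromℕ 1000
      0<1000 = 0<fromℕ-suc 999

theorem1p3 : (ℛ : RealNumbers) → let open RealNumbers ℛ in
    ∃[ A ] Dicut.PolynomialTime ℛ A × Dicut.Competitive ℛ A (fromℕ 483 / fromℕ 1000)
theorem1p3 ℛ = algorithm , Guarantee.polynomialTime ℛ , Guarantee.competitive ℛ
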